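{- If $A$ is a $\phi$-maximizing matrix on $K_4$, then $A$ is fully indecomposable.
   Context: $K_n$ denotes the set of all $n\times n$ real matrices with nonnegative entries whose entries sum to $n$. For $X\in K_n$ with row sums $r_1,\dots,r_n$ and column sums $c_1,\dots,c_n$, define $\phi(X)=\prod_{i=1}^n r_i+\prod_{j=1}^n c_j-\operatorname{per}(X)$, where $\operatorname{per}(X)=\sum_{\sigma\in S_n}\prod_{i=1}^n x_{i\sigma(i)}$. A matrix $A\in K_n$ is $\phi$-maximizing on $K_n$ if $\phi(A)\ge\phi(X)$ for all $X\in K_n$. An $n\times n$ matrix is fully indecomposable if it contains no $s\times t$ zero submatrix with $s+t=n$. -}

module Defs where

open import Data.Nat using (ℕ; zero; suc; _+_; _≥_)
open import Data.Fin using (Fin; zero; suc)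
open import Data.Fin.Subset using (Subset; _∈_; ∣_∣)
open import Data.List using (List; []; _∷_; concatMap; map; foldr; zipWith)
open import Data.List as L using ()
open import Data.Product using (Σ; ∃; _×_; _,_)
open import Relation.Binary.PropositionalEquality using (_≡_)
open import Relation.Nullary using (¬_)
open import Algebra.Structures using (IsCommutativeRing)
open import Data.Sum using (_⊎_)

record RealField : Set₁ where
  infixl 6 _+ᴿ_
  infixl 7 _*ᴿ_
  infix 4 _≤ᴿ_
  field
    ℝ      : Set
    _+ᴿ_   : ℝ → ℝ → ℝ
    _*ᴿ_   : ℝ → ℝ → ℝ
    -ᴿ_    : ℝ → ℝ
    0ᴿ     : ℝ
    1ᴿ     : ℝ
    _≤ᴿ_   : ℝ → ℝ → Set
    isCommutativeRing : IsCommutativeRing _≡_ _+ᴿ_ _*ᴿ_ -ᴿ_ 0ᴿ 1ᴿ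
    0≢1    : ¬ (0ᴿ ≡ 1ᴿ)
    inverse : ∀ x → ¬ (x ≡ 0ᴿ) → Σ ℝ (λ y → x *ᴿ y ≡ 1ᴿ)
    ≤-refl    : ∀ x → x ≤ᴿ x
    ≤-trans   : ∀ {x y z} → x ≤ᴿ y → y ≤ᴿ z → x ≤ᴿ z
    ≤-antisym : ∀ {x y} → x ≤ᴿ y → y ≤ᴿ x → x ≡ y
    ≤-total   : ∀ x y → (x ≤ᴿ y) ⊎ (y ≤ᴿ x)
    +-mono-≤  : ∀ {x y} z → x ≤ᴿ y → x +ᴿ z ≤ᴿ y +ᴿ z
    *-nonneg  : ∀ {x y} → 0ᴿ ≤ᴿ x → 0ᴿ ≤ᴿ y → 0ᴿ ≤ᴿ x *ᴿ y
    sup : (P : ℝ → Set) → Σ ℝ P → Σ ℝ (λ b → ∀ x → P x → x ≤ᴿ b) →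
          Σ ℝ (λ s → (∀ x → P x → x ≤ᴿ s) ×
                     (∀ b → (∀ x → P x → x ≤ᴿ b) → s ≤ᴿ b))

module OverReals (R : RealField) where
  open RealField R

  Matrix : ℕ → Set
  Matrix n = Fin n → Fin n → ℝ

  Σᶠ : (n : ℕ) → (Fin n → ℝ) → ℝ
  Σᶠ zero    f = 0ᴿ
  Σᶠ (suc n) f = f zero +ᴿ Σᶠ n (λ i → f (suc i))

  Πᶠ : (n : ℕ) → (Fin n → ℝ) → ℝ
  Πᶠ zero    f = 1ᴿ
  Πᶠ (suc n) f = f zero *ᴿ Πᶠ n (λ i → f (suc i))

  ℕ→ℝ : ℕ → ℝ
  ℕ→ℝ zero    = 0ᴿ
  ℕ→ℝ (suc n) = 1ᴿ +ᴿ ℕ→ℝ n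

  rowSum : ∀ {n} → Matrix n → Fin n → ℝ
  rowSum {n} X i = Σᶠ n (λ j → X i j)

  colSum : ∀ {n} → Matrix n → Fin n → ℝ
  colSum {n} X j = Σᶠ n (λ i → X i j)

  totalSum : ∀ {n} → Matrix n → ℝ
  totalSum {n} X = Σᶠ n (λ i → rowSum X i)

  -- all permutations of a list (each σ ∈ S_n is listed once as the
  -- list [σ(1), …, σ(n)] when applied to [1, …, n])
  insertions : {A : Set} → A → List A → List (List A)
  insertions x []       = (x ∷ []) ∷ []
  insertions x (y ∷ ys) = (x ∷ y ∷ ys) ∷ map (y ∷_) (insertions x ys)

  permutations : {A : Set} → List A → List (List A)
  permutations []       = [] ∷ []
  permutations (x ∷ xs) = concatMap (insertions x) (permutations xs)

  sumL : List ℝ → ℝ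
  sumL = foldr _+ᴿ_ 0ᴿ

  prodL : List ℝ → ℝ
  prodL = foldr _*ᴿ_ 1ᴿ

  per : ∀ {n} → Matrix n → ℝ
  per {n} X = sumL (map (λ σ → prodL (zipWith X (L.allFin n) σ))
                        (permutations (L.allFin n)))

  φ : ∀ {n} → Matrix n → ℝ
  φ {n} X = (Πᶠ n (rowSum X) +ᴿ Πᶠ n (colSum X)) +ᴿ (-ᴿ per X)

  InK : (n : ℕ) → Matrix n → Set
  InK n X = (∀ i j → 0ᴿ ≤ᴿ X i j) × (totalSum X ≡ ℕ→ℝ n)

  PhiMaximizing : (n : ℕ) → Matrix n → Set
  PhiMaximizing n A = InK n A × (∀ X → InK n X → φ X ≤ᴿ φ A)

  HasZeroSubmatrix : (n : ℕ) → Matrix n → Set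
  HasZeroSubmatrix n X =
    Σ (Subset n) λ S → Σ (Subset n) λ T →
      (∣ S ∣ ≥ 1) × (∣ T ∣ ≥ 1) × (∣ S ∣ + ∣ T ∣ ≡ n) ×
      (∀ i j → i ∈ S → j ∈ T → X i j ≡ 0ᴿ)

  FullyIndecomposable : (n : ℕ) → Matrix n → Set
  FullyIndecomposable n X = ¬ HasZeroSubmatrix n X

{-# OPTIONS --safe #-}
module Submission where

-- The constant matrix J gives max φ ≥ 61/32, so in a maximizing matrix the products of row sums and of
-- column sums are both at least 29/32 and all line sums are close to 1.  By permuting lines
-- and transposing, a zero block can be moved to the top left corner and is 2 × 2 or 1 × 3.
--
-- A 2 × 2 zero block makes the permanent a product of two 2 × 2 permanents, each bounded below
-- in terms of the line sums; this bound contradicts φ ≥ 61/32 directly.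
--
-- For a top row (0, 0, 0, a), moving mass from a to the zeros, or scaling the rest of the matrix
-- down in favour of a, must not increase φ.  Writing p for the permanent of the complementary
-- 3 × 3 block and w for the mass below a, the resulting first-order conditions force w = p = 0.
-- But then a zero pattern making p vanish contains a 2 × 2 zero block, which was just excluded.

open import Algebra.Bundles using (CommutativeRing)
open import Algebra.Solver.Ring.AlmostCommutativeRing using (fromCommutativeRing; _-Raw-AlmostCommutative⟶_)
import Algebra.Solver.Ring as RingSolver
import Algebra.Properties.AbelianGroup as AbelianGroupProperties
import Algebra.Properties.Ring as RingProperties
import Algebra.Properties.Semiring.Mult.TCOptimised as Mult
open import Data.Bool using (true; false)
open import Data.Empty using (⊥; ⊥-elim)
open import Data.Fin using (Fin; zero; suc; combine)
open import Data.Fin.Patterns using (0F; 1F; 2F; 3F)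
open import Data.Fin.Subset using (Subset; _∈_; ∣_∣; ⁅_⁆; _∪_)
open import Data.Fin.Subset.Properties using (x∈p∪q⁻; x∈⁅y⁆⇒x≡y)
open import Data.Integer as ℤ using (ℤ; -[1+_]; _⊖_)
import Data.Integer.Properties as ℤₚ
open import Data.List using (map; foldr; zipWith; allFin)
open import Data.List.Properties using (map-cong; zipWith-cong)
open import Data.Maybe as Maybe using (Maybe)
open import Data.Nat as ℕ using (ℕ; zero; suc; _≥_)
import Data.Nat.Properties as ℕₚ
open import Data.Product using (_×_; _,_; proj₁; proj₂)
open import Data.Sum using (inj₁; inj₂)
open import Data.Vec using (Vec; []; _∷_; lookup; tabulate; concat; here; there)
open import Defs
open import Function using (_∘_)
open import Relation.Binary.PropositionalEquality using (_≡_; refl; sym; trans; cong; cong₂; subst; module ≡-Reasoning)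
open import Relation.Nullary using (¬_)
open import Relation.Nullary.Decidable using (dec⇒maybe)

-- The value 61/32 is 2 - 4!/4⁴. Four nonnegative numbers of sum 4 have product at most 1, so the
-- two products of line sums and the permanent share a slack of only 3/32, and crude rational
-- estimates suffice. The order is total but not decidable, and roots and derivatives are avoided:
-- inequalities are polynomial certificates, a square root is replaced by splitting the range of a
-- quadratic quantity, and first-order conditions come from testing explicit curves in `InK`. For a
-- top row (0, 0, 0, a) the conditions at the zeros are one-sided. Weighting each by the sum of its
-- column eliminates the minors of the zeros and leaves 7w ≥ 24zC + 3p, where z is the excess of the
-- last column sum over 1 and C the product of the other column sums. The condition at the corner,
-- with C ≥ 1/2, gives z ≥ 0 and 7w ≤ 22zC. The gap between 22 and 24 forces w = p = 0.

swapAt : ∀ {n} → Fin n → Fin (suc n) → Fin (suc n)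
swapAt zero    zero          = suc zero
swapAt zero    (suc zero)    = zero
swapAt zero    (suc (suc i)) = suc (suc i)
swapAt (suc k) zero          = zero
swapAt (suc k) (suc i)       = suc (swapAt k i)

swapSet : ∀ {n} → Fin n → Subset (suc n) → Subset (suc n)
swapSet zero    (a ∷ b ∷ S) = b ∷ a ∷ S
swapSet (suc k) (a ∷ S)     = a ∷ swapSet k S

∈-swapSet : ∀ {n} (k : Fin n) S {i} → i ∈ swapSet k S → swapAt k i ∈ S
∈-swapSet zero    (a ∷ b ∷ S) here                 = there here
∈-swapSet zero    (a ∷ b ∷ S) (there here)         = here
∈-swapSet zero    (a ∷ b ∷ S) (there (there p))    = there (there p)
∈-swapSet (suc k) (a ∷ S)     here                 = here
∈-swapSet (suc k) (a ∷ S)     (there p)            = there (∈-swapSet k S p)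

-- A list of adjacent transpositions, kept so that `noZeroBlock-rows` can replay it on the matrix
-- one transposition at a time.
data _↝_ : Subset 4 → Subset 4 → Set where
  done : ∀ {S} → S ↝ S
  step : ∀ {S T} k → swapSet k S ↝ T → S ↝ T

initial : ℕ → Subset 4
initial 0 = false ∷ false ∷ false ∷ false ∷ []
initial 1 = true ∷ false ∷ false ∷ false ∷ []
initial 2 = true ∷ true ∷ false ∷ false ∷ []
initial 3 = true ∷ true ∷ true ∷ false ∷ []
initial _ = true ∷ true ∷ true ∷ true ∷ []

sort : ∀ S → S ↝ initial ∣ S ∣
sort (false ∷ false ∷ false ∷ false ∷ []) = done
sort (true  ∷ false ∷ false ∷ false ∷ []) = done
sort (false ∷ true  ∷ false ∷ false ∷ []) = step 0F done
sort (false ∷ false ∷ true  ∷ false ∷ []) = step 1F (step 0F done)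
sort (false ∷ false ∷ false ∷ true  ∷ []) = step 2F (step 1F (step 0F done))
sort (true  ∷ true  ∷ false ∷ false ∷ []) = done
sort (true  ∷ false ∷ true  ∷ false ∷ []) = step 1F done
sort (true  ∷ false ∷ false ∷ true  ∷ []) = step 2F (step 1F done)
sort (false ∷ true  ∷ true  ∷ false ∷ []) = step 0F (step 1F done)
sort (false ∷ true  ∷ false ∷ true  ∷ []) = step 0F (step 2F (step 1F done))
sort (false ∷ false ∷ true  ∷ true  ∷ []) = step 1F (step 0F (step 2F (step 1F done)))
sort (true  ∷ true  ∷ true  ∷ false ∷ []) = done
sort (true  ∷ true  ∷ false ∷ true  ∷ []) = step 2F done
sort (true  ∷ false ∷ true  ∷ true  ∷ []) = step 1F (step 2F done)
sort (false ∷ true  ∷ true  ∷ true  ∷ []) = step 0F (step 1F (step 2F done))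
sort (true  ∷ true  ∷ true  ∷ true  ∷ []) = done

-- Integer coefficients for a ring solver over the reals

module IntegerCoefficients (R : RealField) where
  open RealField R
  open import Data.Integer using (+_)

  commutativeRing : CommutativeRing _ _
  commutativeRing = record { isCommutativeRing = isCommutativeRing }

  open CommutativeRing commutativeRing
    using (ring; semiring; +-abelianGroup; +-assoc; +-comm; +-identityʳ; +-identityˡ; -‿inverseʳ)
  open RingProperties ring using (-‿distribˡ-*; -‿distribʳ-*; -0#≈0#; -‿involutive)
  open AbelianGroupProperties +-abelianGroup using (⁻¹-∙-comm)
  open Mult semiring using (1+×; ×-homo-+; ×1-homo-*) renaming (_×_ to infixl 8 _×′_)

  -- This form of multiple makes `num 1` reduce to `1ᴿ`, and `num (suc (suc n))` to
  -- `num (suc n) +ᴿ 1ᴿ`, on which `1-homo` and `num≥0` rely.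
  ι : ℤ → ℝ
  ι (+ n)    = n ×′ 1ᴿ
  ι -[1+ n ] = -ᴿ (suc n ×′ 1ᴿ)

  ι-⊖ : ∀ m n → ι (m ⊖ n) ≡ m ×′ 1ᴿ +ᴿ -ᴿ (n ×′ 1ᴿ)
  ι-⊖ zero    zero    = sym (-‿inverseʳ 0ᴿ)
  ι-⊖ zero    (suc n) = sym (+-identityˡ _)
  ι-⊖ (suc m) zero    = sym (trans (cong (suc m ×′ 1ᴿ +ᴿ_) -0#≈0#) (+-identityʳ _))
  ι-⊖ (suc m) (suc n) = begin
    ι (suc m ⊖ suc n)                              ≡⟨ cong ι (ℤₚ.[1+m]⊖[1+n]≡m⊖n m n) ⟩
    ι (m ⊖ n)                                      ≡⟨ ι-⊖ m n ⟩
    x +ᴿ -ᴿ y                                      ≡⟨ cong (_+ᴿ -ᴿ y) (sym (+-identityˡ x)) ⟩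
    (0ᴿ +ᴿ x) +ᴿ -ᴿ y                              ≡⟨ cong (λ u → (u +ᴿ x) +ᴿ -ᴿ y) (sym (-‿inverseʳ 1ᴿ)) ⟩
    ((1ᴿ +ᴿ -ᴿ 1ᴿ) +ᴿ x) +ᴿ -ᴿ y                   ≡⟨ cong (_+ᴿ -ᴿ y) (+-assoc 1ᴿ (-ᴿ 1ᴿ) x) ⟩
    (1ᴿ +ᴿ (-ᴿ 1ᴿ +ᴿ x)) +ᴿ -ᴿ y                   ≡⟨ cong (λ u → (1ᴿ +ᴿ u) +ᴿ -ᴿ y) (+-comm (-ᴿ 1ᴿ) x) ⟩
    (1ᴿ +ᴿ (x +ᴿ -ᴿ 1ᴿ)) +ᴿ -ᴿ y                   ≡⟨ cong (_+ᴿ -ᴿ y) (sym (+-assoc 1ᴿ x (-ᴿ 1ᴿ))) ⟩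
    ((1ᴿ +ᴿ x) +ᴿ -ᴿ 1ᴿ) +ᴿ -ᴿ y                   ≡⟨ +-assoc (1ᴿ +ᴿ x) (-ᴿ 1ᴿ) (-ᴿ y) ⟩
    (1ᴿ +ᴿ x) +ᴿ (-ᴿ 1ᴿ +ᴿ -ᴿ y)                   ≡⟨ cong ((1ᴿ +ᴿ x) +ᴿ_) (⁻¹-∙-comm 1ᴿ y) ⟩
    (1ᴿ +ᴿ x) +ᴿ -ᴿ (1ᴿ +ᴿ y)                      ≡⟨ cong₂ (λ u v → u +ᴿ -ᴿ v) (sym (1+× m 1ᴿ)) (sym (1+× n 1ᴿ)) ⟩
    suc m ×′ 1ᴿ +ᴿ -ᴿ (suc n ×′ 1ᴿ)                ∎
    where
    open ≡-Reasoning
    x = m ×′ 1ᴿ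
    y = n ×′ 1ᴿ

  ι-+ : ∀ i j → ι (i ℤ.+ j) ≡ ι i +ᴿ ι j
  ι-+ (+ m)    (+ n)    = ×-homo-+ 1ᴿ m n
  ι-+ (+ m)    -[1+ n ] = ι-⊖ m (suc n)
  ι-+ -[1+ m ] (+ n)    = trans (ι-⊖ n (suc m)) (+-comm _ _)
  ι-+ -[1+ m ] -[1+ n ] = begin
    -ᴿ (suc (suc (m ℕ.+ n)) ×′ 1ᴿ)         ≡⟨ cong (λ k → -ᴿ (k ×′ 1ᴿ)) (cong suc (sym (ℕₚ.+-suc m n))) ⟩
    -ᴿ ((suc m ℕ.+ suc n) ×′ 1ᴿ)           ≡⟨ cong -ᴿ_ (×-homo-+ 1ᴿ (suc m) (suc n)) ⟩
    -ᴿ (suc m ×′ 1ᴿ +ᴿ suc n ×′ 1ᴿ)        ≡⟨ sym (⁻¹-∙-comm _ _) ⟩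
    -ᴿ (suc m ×′ 1ᴿ) +ᴿ -ᴿ (suc n ×′ 1ᴿ)   ∎
    where open ≡-Reasoning

  ι-neg : ∀ i → ι (ℤ.- i) ≡ -ᴿ ι i
  ι-neg (+ zero)  = sym -0#≈0#
  ι-neg (+ suc n) = refl
  ι-neg -[1+ n ]  = sym (-‿involutive _)

  ι-*ʳ : ∀ m j → ι (+ m ℤ.* j) ≡ ι (+ m) *ᴿ ι j
  ι-*ʳ m (+ n)    = trans (cong ι (sym (ℤₚ.pos-* m n))) (×1-homo-* m n)
  ι-*ʳ m -[1+ n ] = begin
    ι (+ m ℤ.* ℤ.- j)     ≡⟨ cong ι (ℤₚ.neg-distribʳ-* (+ m) j) ⟨
    ι (ℤ.- (+ m ℤ.* j))   ≡⟨ ι-neg (+ m ℤ.* j) ⟩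
    -ᴿ ι (+ m ℤ.* j)      ≡⟨ cong -ᴿ_ (ι-*ʳ m j) ⟩
    -ᴿ (ι (+ m) *ᴿ ι j)   ≡⟨ -‿distribʳ-* _ _ ⟩
    ι (+ m) *ᴿ -ᴿ ι j     ∎
    where
    open ≡-Reasoning
    j = + suc n

  ι-* : ∀ i j → ι (i ℤ.* j) ≡ ι i *ᴿ ι j
  ι-* (+ m)    j = ι-*ʳ m j
  ι-* -[1+ m ] j = begin
    ι (ℤ.- i ℤ.* j)     ≡⟨ cong ι (ℤₚ.neg-distribˡ-* i j) ⟨
    ι (ℤ.- (i ℤ.* j))   ≡⟨ ι-neg (i ℤ.* j) ⟩
    -ᴿ ι (i ℤ.* j)      ≡⟨ cong -ᴿ_ (ι-*ʳ (suc m) j) ⟩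
    -ᴿ (ι i *ᴿ ι j)     ≡⟨ -‿distribˡ-* _ _ ⟩
    -ᴿ ι i *ᴿ ι j       ∎
    where
    open ≡-Reasoning
    i = + suc m

  ι-morphism : ℤ.+-*-rawRing -Raw-AlmostCommutative⟶ fromCommutativeRing commutativeRing
  ι-morphism = record
    { ⟦_⟧ = ι ; +-homo = ι-+ ; *-homo = ι-* ; -‿homo = ι-neg ; 0-homo = refl ; 1-homo = refl }

  _ι≟_ : ∀ i j → Maybe (ι i ≡ ι j)
  i ι≟ j = Maybe.map (cong ι) (dec⇒maybe (i ℤₚ.≟ j))

  open RingSolver ℤ.+-*-rawRing (fromCommutativeRing commutativeRing) ι-morphism _ι≟_ public
    using (Polynomial; solve; prove; _:=_; con; var; _:+_; _:*_; _:-_; :-_)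

  num : ℕ → ℝ
  num n = ι (+ n)

  :num : ∀ {k} → ℕ → Polynomial k
  :num n = con (+ n)

  num-+ : ∀ m n → num (m ℕ.+ n) ≡ num m +ᴿ num n
  num-+ m n = ι-+ (+ m) (+ n)

module Proof (R : RealField) where
  open RealField R renaming
    ( _+ᴿ_ to infixl 6 _+_; _*ᴿ_ to infixl 7 _*_; -ᴿ_ to infix 8 -_
    ; 0ᴿ to 0#; 1ᴿ to 1#; _≤ᴿ_ to infix 4 _≤_ )
  open OverReals R
  open IntegerCoefficients R
  open CommutativeRing commutativeRing using (*-identityˡ)

  -- Order arithmetic and certificates of nonnegativity

  infixl 6 _-_
  _-_ : ℝ → ℝ → ℝ
  x - y = x + - y

  infix 9 _² _:²
  _² : ℝ → ℝ
  x ² = x * x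

  _:² : ∀ {k} → Polynomial k → Polynomial k
  p :² = p :* p

  -- The order is not assumed decidable, so positivity is a negation and limiting
  -- arguments only yield conclusions of the form ¬ Pos x, that is ¬ ¬ (x ≤ 0#).
  NonNeg Pos : ℝ → Set
  NonNeg x = 0# ≤ x
  Pos x = ¬ (x ≤ 0#)

  -- The shape of nearly every inequality below: a combination of visibly nonnegative terms, which
  -- the ring solver identifies with the goal. A contradiction arises when the combination equals a
  -- negative integer.
  by : ∀ {x y} → NonNeg x → x ≡ y → NonNeg y
  by p e = subst NonNeg e p

  ≤⇒NonNeg : ∀ {x y} → x ≤ y → NonNeg (y - x)
  ≤⇒NonNeg {x} {y} p = subst (_≤ y - x) (solve 1 (λ x → x :- x := :num 0) refl x) (+-mono-≤ (- x) p)

  NonNeg⇒≤ : ∀ {x y} → NonNeg (y - x) → x ≤ y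
  NonNeg⇒≤ {x} {y} p = subst (_≤ y) (solve 1 (λ x → :num 0 :+ x := x) refl x) (subst (0# + x ≤_) (solve 2 (λ x y → y :- x :+ x := y) refl x y) (+-mono-≤ x p))

  infixl 6 _⊕_
  infixl 7 _⊗_

  _⊕_ : ∀ {x y} → NonNeg x → NonNeg y → NonNeg (x + y)
  _⊕_ {x} {y} p q = ≤-trans q (subst (_≤ x + y) (solve 1 (λ y → :num 0 :+ y := y) refl y) (+-mono-≤ y p))

  _⊗_ : ∀ {x y} → NonNeg x → NonNeg y → NonNeg (x * y)
  _⊗_ = *-nonneg

  sq≥0 : ∀ x → NonNeg (x ²)
  sq≥0 x with ≤-total 0# x
  ... | inj₁ p = p ⊗ p
  ... | inj₂ p = by (≤⇒NonNeg p ⊗ ≤⇒NonNeg p) (solve 1 (λ x → (:num 0 :- x) :² := x :²) refl x)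

  num≥0 : ∀ n → NonNeg (num n)
  num≥0 0             = ≤-refl 0#
  num≥0 1             = by (sq≥0 1#) (*-identityˡ 1#)
  num≥0 (suc (suc n)) = num≥0 (suc n) ⊕ num≥0 1

  Pos⇒NonNeg : ∀ {x} → Pos x → NonNeg x
  Pos⇒NonNeg {x} p with ≤-total 0# x
  ... | inj₁ q = q
  ... | inj₂ q = ⊥-elim (p q)

  Pos-1 : Pos 1#
  Pos-1 p = 0≢1 (≤-antisym (num≥0 1) p)

  Pos-+ : ∀ {x y} → Pos x → NonNeg y → Pos (x + y)
  Pos-+ {x} {y} p q r = p (NonNeg⇒≤ (by (≤⇒NonNeg r ⊕ q) (solve 2 (λ x y → :num 0 :- (x :+ y) :+ y := :num 0 :- x) refl x y)))

  Pos-num : ∀ n → Pos (num (suc n))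
  Pos-num 0       = Pos-1
  Pos-num (suc n) = Pos-+ (Pos-num n) (num≥0 1)

  negative-absurd : ∀ n → NonNeg (ι -[1+ n ]) → ⊥
  negative-absurd n p = Pos-num n (NonNeg⇒≤ (by p (solve 1 (λ x → :- x := :num 0 :- x) refl (num (suc n)))))

  Pos-mono : ∀ {x y} → Pos x → NonNeg (y - x) → Pos y
  Pos-mono {x} {y} p q r = p (NonNeg⇒≤ (by (q ⊕ ≤⇒NonNeg r) (solve 2 (λ x y → y :- x :+ (:num 0 :- y) := :num 0 :- x) refl x y)))

  -- If `y ≤ 0#`, the product is squeezed to zero, and multiplying by the inverse of `x` gives
  -- `y ≡ 0#`.
  cancel-NonNeg : ∀ {x y} → Pos x → NonNeg (x * y) → NonNeg y
  cancel-NonNeg {x} {y} p q with ≤-total 0# y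
  ... | inj₁ r = r
  ... | inj₂ r = subst NonNeg (sym y≡0) (≤-refl 0#)
    where
    xy≡0 : x * y ≡ 0#
    xy≡0 = ≤-antisym (NonNeg⇒≤ (by (Pos⇒NonNeg p ⊗ ≤⇒NonNeg r) (solve 2 (λ x y → x :* (:num 0 :- y) := :num 0 :- x :* y) refl x y))) q
    x⁻¹ = inverse x (λ e → p (subst (_≤ 0#) (sym e) (≤-refl 0#)))
    y≡0 : y ≡ 0#
    y≡0 = begin
      y                       ≡⟨ solve 1 (λ y → y := :num 1 :* y) refl y ⟩
      1# * y                  ≡⟨ cong (_* y) (sym (proj₂ x⁻¹)) ⟩
      x * proj₁ x⁻¹ * y       ≡⟨ solve 3 (λ x y z → x :* z :* y := z :* (x :* y)) refl x y (proj₁ x⁻¹) ⟩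
      proj₁ x⁻¹ * (x * y)     ≡⟨ cong (proj₁ x⁻¹ *_) xy≡0 ⟩
      proj₁ x⁻¹ * 0#          ≡⟨ solve 1 (λ z → z :* :num 0 := :num 0) refl (proj₁ x⁻¹) ⟩
      0#                      ∎
      where open ≡-Reasoning

  Pos-* : ∀ {x y} → Pos x → Pos y → Pos (x * y)
  Pos-* {x} {y} p q r = q (NonNeg⇒≤ (cancel-NonNeg p (by (≤⇒NonNeg r) (solve 2 (λ x y → :num 0 :- x :* y := x :* (:num 0 :- y)) refl x y))))

  difference≥0 : ∀ m n → NonNeg (num (m ℕ.+ n) - num n)
  difference≥0 m n = by (num≥0 m) (trans (solve 2 (λ x y → x := x :+ y :- y) refl (num m) (num n)) (cong (_- num n) (sym (num-+ m n))))

  -- From the tangent-line bound 2sx ≤ s² + x².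
  sq-bound : ∀ s x → Pos s → NonNeg (s ² - x ²) → NonNeg (s - x)
  sq-bound s x s>0 p = cancel-NonNeg (Pos-+ s>0 (Pos⇒NonNeg s>0)) (by (p ⊕ sq≥0 (s - x))
    (solve 2 (λ s x → s :² :- x :² :+ (s :- x) :² := (s :+ s) :* (s :- x)) refl s x))

  sq-mono : ∀ {x y} → NonNeg x → NonNeg (y - x) → NonNeg (y ² - x ²)
  sq-mono {x} {y} p q = by (q ⊗ (q ⊕ p ⊕ p))
    (solve 2 (λ x y → (y :- x) :* (y :- x :+ x :+ x) := y :² :- x :²) refl x y)

  *-mono : ∀ {x y z w} → NonNeg x → NonNeg z → NonNeg (y - x) → NonNeg (w - z) → NonNeg (y * w - x * z)
  *-mono {x} {y} {z} {w} p q r s = by (r ⊗ (s ⊕ q) ⊕ p ⊗ s)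
    (solve 4 (λ x y z w → (y :- x) :* (w :- z :+ z) :+ x :* (w :- z) := y :* w :- x :* z) refl x y z w)

  -- The lower bounds `u - α` and `v - γ` may be negative and cannot then be multiplied. If one of
  -- them is nonpositive, the claimed bound is itself at most zero; otherwise their product exceeds
  -- it by `α * γ`.
  product-lower-bound : ∀ {u v α γ b d} → NonNeg u → NonNeg v → NonNeg α → NonNeg γ → NonNeg b → NonNeg d →
    NonNeg (b - (u - α)) → NonNeg (d - (v - γ)) → NonNeg (b * d - (u * v - α * v - γ * u))
  product-lower-bound {u} {v} {α} {γ} {b} {d} hu hv hα hγ hb hd p q with ≤-total α u | ≤-total γ v
  ... | inj₂ r | _      = by (hb ⊗ hd ⊕ ≤⇒NonNeg r ⊗ hv ⊕ hγ ⊗ hu)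
    (solve 6 (λ u v α γ b d → b :* d :+ (α :- u) :* v :+ γ :* u := b :* d :- (u :* v :- α :* v :- γ :* u)) refl u v α γ b d)
  ... | inj₁ _ | inj₂ r = by (hb ⊗ hd ⊕ ≤⇒NonNeg r ⊗ hu ⊕ hα ⊗ hv)
    (solve 6 (λ u v α γ b d → b :* d :+ (γ :- v) :* u :+ α :* v := b :* d :- (u :* v :- α :* v :- γ :* u)) refl u v α γ b d)
  ... | inj₁ r | inj₁ s = by (*-mono (≤⇒NonNeg r) (≤⇒NonNeg s) p q ⊕ hα ⊗ hγ)
    (solve 6 (λ u v α γ b d → b :* d :- (u :- α) :* (v :- γ) :+ α :* γ := b :* d :- (u :* v :- α :* v :- γ :* u)) refl u v α γ b d)

  -- Scalar inequalities for the 2 × 2 zero block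

  minus-diff : ℝ → ℝ → ℝ
  minus-diff x ρ = (num 2 - x) ² - ρ ²

  -- Four times the product of two line sums with total `2 + x` and difference `η`; `minus-diff` is
  -- the analogue for total `2 - x`.
  plus-diff : ℝ → ℝ → ℝ
  plus-diff x η = (num 2 + x) ² - η ²

  -- What `per₂-lower-bound` guarantees for eight times the permanent of a block of entry sum
  -- `2 - x` when the paired line sums agree; `x + y` is the entry sum of the block opposite the
  -- zeros.
  core : ℝ → ℝ → ℝ
  core x y = (num 2 - x) ² - num 2 * (x + y) ²

  diff-product : ∀ x ρ η → NonNeg (plus-diff x η) →
    NonNeg ((num 4 - x ²) ² - minus-diff x ρ * plus-diff x η)
  diff-product x ρ η p = by (sq≥0 ρ ⊗ p ⊕ sq≥0 (num 2 - x) ⊗ sq≥0 η)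
    (solve 3 (λ x ρ η → ρ :² :* ((:num 2 :+ x) :² :- η :²) :+ (:num 2 :- x) :² :* η :²
      := (:num 4 :- x :²) :² :- ((:num 2 :- x) :² :- ρ :²) :* ((:num 2 :+ x) :² :- η :²)) refl x ρ η)

  -- Here `x ² + y ²` is at most N/1600, so `(x + y) ²` is at most N/800. The number p/20 is a
  -- rational upper bound for x, since N/1600 is at most its square.
  core-lower-bound : ∀ p N x y → Pos p → NonNeg (num 40 - p) → NonNeg (num 4 * p ² - N) →
    NonNeg (N - num 1600 * (x ² + y ²)) → NonNeg (num 400 * core x y - ((num 40 - p) ² - N))
  core-lower-bound p N x y p>0 p≤40 hp hN = by (sq-mono p≤40 linear ⊕ hN ⊕ num≥0 800 ⊗ sq≥0 (x - y))
    (solve 4 (λ p N x y → (:num 20 :* (:num 2 :- x)) :² :- (:num 40 :- p) :² :+ (N :- :num 1600 :* (x :² :+ y :²)) :+ :num 800 :* (x :- y) :²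
      := :num 400 :* ((:num 2 :- x) :² :- :num 2 :* (x :+ y) :²) :- ((:num 40 :- p) :² :- N)) refl p N x y)
    where
    linear : NonNeg (num 20 * (num 2 - x) - (num 40 - p))
    linear = by (sq-bound p (num 20 * x) p>0 (cancel-NonNeg (Pos-num 3) (by (hp ⊕ hN ⊕ num≥0 1600 ⊗ sq≥0 y)
      (solve 4 (λ p N x y → :num 4 :* p :² :- N :+ (N :- :num 1600 :* (x :² :+ y :²)) :+ :num 1600 :* y :²
        := :num 4 :* (p :² :- (:num 20 :* x) :²)) refl p N x y))))
      (solve 2 (λ p x → p :- :num 20 :* x := :num 20 :* (:num 2 :- x) :- (:num 40 :- p)) refl p x)

  -- Dividing 29/2 by 25/4 gives s ≥ 58/25, so 4s exceeds 9, whereas v is at most 25/4.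
  big-factor : ∀ {r s v} → NonNeg s → NonNeg (num 25 - num 4 * r) → NonNeg (num 2 * (r * s) - num 29) →
    NonNeg (num 25 - num 4 * v) → NonNeg (num 4 * s - v)
  big-factor {r} {s} {v} hs hr hrs hv = cancel-NonNeg (Pos-num 99)
    (by (num≥0 16 ⊗ (hr ⊗ hs ⊕ num≥0 2 ⊗ hrs) ⊕ num≥0 25 ⊗ hv ⊕ num≥0 303)
    (solve 3 (λ r s v → :num 16 :* ((:num 25 :- :num 4 :* r) :* s :+ :num 2 :* (:num 2 :* (r :* s) :- :num 29)) :+ :num 25 :* (:num 25 :- :num 4 :* v) :+ :num 303
      := :num 100 :* (:num 4 :* s :- v)) refl r s v))

  square-bound : ∀ x y → NonNeg (num 2 - x) → NonNeg (num 1 - num 5 * (x ² + y ²)) → NonNeg (num 25 - num 4 * (num 2 - x) ²)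
  square-bound x y x≤2 q = by (sq-mono (num≥0 2 ⊗ x≤2) -1/2≤x)
    (solve 1 (λ x → :num 5 :² :- (:num 2 :* (:num 2 :- x)) :² := :num 25 :- :num 4 :* (:num 2 :- x) :²) refl x)
    where
    -1/2≤x : NonNeg (num 5 - num 2 * (num 2 - x))
    -1/2≤x = by (sq-bound (num 1) (- (num 2 * x)) Pos-1 (cancel-NonNeg (Pos-num 4) (by (num≥0 4 ⊗ q ⊕ num≥0 20 ⊗ sq≥0 y ⊕ num≥0 1)
        (solve 2 (λ x y → :num 4 :* (:num 1 :- :num 5 :* (x :² :+ y :²)) :+ :num 20 :* y :² :+ :num 1 := :num 5 :* ((:num 1) :² :- (:- (:num 2 :* x)) :²)) refl x y))))
      (solve 1 (λ x → :num 1 :- (:- (:num 2 :* x)) := :num 5 :- :num 2 :* (:num 2 :- x)) refl x)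

  minus-small : ∀ x ρ → NonNeg (num 25 - num 4 * (num 2 - x) ²) → NonNeg (num 25 - num 4 * minus-diff x ρ)
  minus-small x ρ p = by (p ⊕ num≥0 4 ⊗ sq≥0 ρ)
    (solve 2 (λ x ρ → :num 25 :- :num 4 :* (:num 2 :- x) :² :+ :num 4 :* ρ :² := :num 25 :- :num 4 :* ((:num 2 :- x) :² :- ρ :²)) refl x ρ)

  core-small : ∀ x y → NonNeg (num 25 - num 4 * (num 2 - x) ²) → NonNeg (num 25 - num 4 * core x y)
  core-small x y p = by (p ⊕ num≥0 8 ⊗ sq≥0 (x + y))
    (solve 2 (λ x y → :num 25 :- :num 4 :* (:num 2 :- x) :² :+ :num 8 :* (x :+ y) :² := :num 25 :- :num 4 :* ((:num 2 :- x) :² :- :num 2 :* (x :+ y) :²)) refl x y)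

  core-slack : ∀ x y → NonNeg (num 4 * (num 2 - x) ² - num 2 * core x y)
  core-slack x y = by (num≥0 2 ⊗ sq≥0 (num 2 - x) ⊕ num≥0 4 ⊗ sq≥0 (x + y))
    (solve 2 (λ x y → :num 2 :* (:num 2 :- x) :² :+ :num 4 :* (x :+ y) :² := :num 4 :* (:num 2 :- x) :² :- :num 2 :* ((:num 2 :- x) :² :- :num 2 :* (x :+ y) :²)) refl x y)

  halve : ∀ {u} → NonNeg (num 2 * u - num 3) → NonNeg u
  halve {u} q = cancel-NonNeg (Pos-num 1) (by (q ⊕ num≥0 3) (solve 1 (λ u → :num 2 :* u :- :num 3 :+ :num 3 := :num 2 :* u) refl u))

  -- The thresholds 2/25, 4/25 and 1/5 for S appear as N = 128, 256 and 320, and p is the least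
  -- integer with 4p² ≥ N. The core bounds 1028/400, 768/400 and 641/400 are rounded down to 5/2,
  -- 19/10 and 3/2.
  rescale₁ : ∀ u → NonNeg (num 400 * u - ((num 40 - num 6) ² - num 128)) → NonNeg (num 2 * u - num 5)
  rescale₁ u q = cancel-NonNeg (Pos-num 199) (by (q ⊕ num≥0 28)
    (solve 1 (λ u → :num 400 :* u :- ((:num 40 :- :num 6) :² :- :num 128) :+ :num 28 := :num 200 :* (:num 2 :* u :- :num 5)) refl u))

  rescale₂ : ∀ u → NonNeg (num 400 * u - ((num 40 - num 8) ² - num 256)) → NonNeg (num 10 * u - num 19)
  rescale₂ u q = cancel-NonNeg (Pos-num 39) (by (q ⊕ num≥0 8)
    (solve 1 (λ u → :num 400 :* u :- ((:num 40 :- :num 8) :² :- :num 256) :+ :num 8 := :num 40 :* (:num 10 :* u :- :num 19)) refl u))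

  rescale₃ : ∀ u → NonNeg (num 400 * u - ((num 40 - num 9) ² - num 320)) → NonNeg (num 2 * u - num 3)
  rescale₃ u q = cancel-NonNeg (Pos-num 199) (by (q ⊕ num≥0 41)
    (solve 1 (λ u → :num 400 :* u :- ((:num 40 :- :num 9) :² :- :num 320) :+ :num 41 := :num 200 :* (:num 2 :* u :- :num 3)) refl u))

  -- X and Y say how far the entry sums of the blocks B and D of TwoByTwo fall short of 2,
  -- and ρ, η, ζ, ε are the differences r₁ - r₂, r₃ - r₄, c₁ - c₂, c₃ - c₄ of paired line sums;
  -- the last hypothesis is 32 φ ≥ 61.  What the permanent loses through these differences
  -- the products of line sums lose more (two-variable), so only X and Y matter.
  module BlockBound (X Y ρ η ε ζ β δ : ℝ)
    (X≤2 : NonNeg (num 2 - X)) (-2≤X : NonNeg (num 2 + X))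
    (Y≤2 : NonNeg (num 2 - Y)) (-2≤Y : NonNeg (num 2 + Y))
    (r'≥0 : NonNeg (plus-diff X η)) (k≥0 : NonNeg (plus-diff Y ε))
    (β≥0 : NonNeg β) (δ≥0 : NonNeg δ)
    (hβ : NonNeg (num 8 * β - (core X Y - (ρ ² + num 2 * ε ²))))
    (hδ : NonNeg (num 8 * δ - (core Y X - (ζ ² + num 2 * η ²))))
    (h : NonNeg (num 2 * (minus-diff X ρ * plus-diff X η + minus-diff Y ζ * plus-diff Y ε) - num 32 * (β * δ) - num 61))
    where

    r = minus-diff X ρ
    r' = plus-diff X η
    k' = minus-diff Y ζ
    k = plus-diff Y ε
    U = core X Y
    V = core Y X
    S = X ² + Y ²

    rows : NonNeg ((num 4 - X ²) ² - r * r')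
    rows = diff-product X ρ η r'≥0
    cols : NonNeg ((num 4 - Y ²) ² - k' * k)
    cols = diff-product Y ζ ε k≥0

    S≥0 : NonNeg S
    S≥0 = sq≥0 X ⊕ sq≥0 Y

    -- Discarding the permanent already forces S to be small.
    S≤3/8 : NonNeg (num 3 - num 8 * S)
    S≤3/8 = by (h ⊕ num≥0 32 ⊗ (β≥0 ⊗ δ≥0) ⊕ num≥0 2 ⊗ rows ⊕ num≥0 2 ⊗ cols
        ⊕ num≥0 2 ⊗ (sq≥0 X ⊗ (X≤2 ⊗ -2≤X)) ⊕ num≥0 2 ⊗ (sq≥0 Y ⊗ (Y≤2 ⊗ -2≤Y)))
      (solve 5 (λ X Y q₁ q₂ b → :num 2 :* (q₁ :+ q₂) :- :num 32 :* b :- :num 61 :+ :num 32 :* b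
          :+ :num 2 :* ((:num 4 :- X :²) :² :- q₁) :+ :num 2 :* ((:num 4 :- Y :²) :² :- q₂)
          :+ :num 2 :* (X :² :* ((:num 2 :- X) :* (:num 2 :+ X))) :+ :num 2 :* (Y :² :* ((:num 2 :- Y) :* (:num 2 :+ Y)))
        := :num 3 :- :num 8 :* (X :² :+ Y :²)) refl X Y (r * r') (k' * k) (β * δ))

    -- A second round, now with S ≤ 3/8: the quartic terms are at most S², hence at most 3S/8, and
    -- the bound sharpens to 61S/4 ≤ 3.
    S≤1/5 : NonNeg (num 1 - num 5 * S)
    S≤1/5 = cancel-NonNeg (Pos-num 11) (by (num≥0 4 ⊗ h ⊕ num≥0 128 ⊗ (β≥0 ⊗ δ≥0) ⊕ num≥0 8 ⊗ rows ⊕ num≥0 8 ⊗ cols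
        ⊕ S≥0 ⊗ S≤3/8 ⊕ num≥0 16 ⊗ (sq≥0 X ⊗ sq≥0 Y) ⊕ S≥0)
      (solve 5 (λ X Y q₁ q₂ b → :num 4 :* (:num 2 :* (q₁ :+ q₂) :- :num 32 :* b :- :num 61) :+ :num 128 :* b
          :+ :num 8 :* ((:num 4 :- X :²) :² :- q₁) :+ :num 8 :* ((:num 4 :- Y :²) :² :- q₂)
          :+ (X :² :+ Y :²) :* (:num 3 :- :num 8 :* (X :² :+ Y :²)) :+ :num 16 :* (X :² :* Y :²) :+ (X :² :+ Y :²)
        := :num 12 :* (:num 1 :- :num 5 :* (X :² :+ Y :²))) refl X Y (r * r') (k' * k) (β * δ)))

    S≤1/5′ : NonNeg (num 1 - num 5 * (Y ² + X ²))
    S≤1/5′ = by S≤1/5 (solve 2 (λ X Y → :num 1 :- :num 5 :* (X :² :+ Y :²) := :num 1 :- :num 5 :* (Y :² :+ X :²)) refl X Y)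

    X-square = square-bound X Y X≤2 S≤1/5
    Y-square = square-bound Y X Y≤2 S≤1/5′

    row-product : NonNeg (num 2 * (r * r') - num 29)
    row-product = by (h ⊕ num≥0 32 ⊗ (β≥0 ⊗ δ≥0) ⊕ num≥0 2 ⊗ cols ⊕ num≥0 2 ⊗ (sq≥0 Y ⊗ (num≥0 4 ⊕ Y≤2 ⊗ -2≤Y)))
      (solve 4 (λ Y q₁ q₂ b → :num 2 :* (q₁ :+ q₂) :- :num 32 :* b :- :num 61 :+ :num 32 :* b
          :+ :num 2 :* ((:num 4 :- Y :²) :² :- q₂) :+ :num 2 :* (Y :² :* (:num 4 :+ (:num 2 :- Y) :* (:num 2 :+ Y)))
        := :num 2 :* q₁ :- :num 29) refl Y (r * r') (k' * k) (β * δ))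

    col-product : NonNeg (num 2 * (k' * k) - num 29)
    col-product = by (h ⊕ num≥0 32 ⊗ (β≥0 ⊗ δ≥0) ⊕ num≥0 2 ⊗ rows ⊕ num≥0 2 ⊗ (sq≥0 X ⊗ (num≥0 4 ⊕ X≤2 ⊗ -2≤X)))
      (solve 4 (λ X q₁ q₂ b → :num 2 :* (q₁ :+ q₂) :- :num 32 :* b :- :num 61 :+ :num 32 :* b
          :+ :num 2 :* ((:num 4 :- X :²) :² :- q₁) :+ :num 2 :* (X :² :* (:num 4 :+ (:num 2 :- X) :* (:num 2 :+ X)))
        := :num 2 :* q₂ :- :num 29) refl X (r * r') (k' * k) (β * δ))

    -- In `two-variable` each unit of ρ² costs `4 r'` in the row product and relaxes the permanent
    -- bound by only `V`. The same comparison for ζ² is `4k≥U`, while `core-slack` settles η² and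
    -- ε².
    4r'≥V : NonNeg (num 4 * r' - V)
    4r'≥V = big-factor r'≥0 (minus-small X ρ X-square) row-product (core-small Y X Y-square)

    4k≥U : NonNeg (num 4 * k - U)
    4k≥U = big-factor k≥0 (minus-small Y ζ Y-square) col-product (core-small X Y X-square)

    S≤1/5-scaled : NonNeg (num 320 - num 1600 * S)
    S≤1/5-scaled = by (num≥0 320 ⊗ S≤1/5) (solve 1 (λ S → :num 320 :* (:num 1 :- :num 5 :* S) := :num 320 :- :num 1600 :* S) refl S)

    module _ (N p l n : ℝ) (p>0 : Pos p) (p≤40 : NonNeg (num 40 - p)) (hp : NonNeg (num 4 * p ² - N)) (n≥0 : NonNeg n)
      (rescale : ∀ u → NonNeg (num 400 * u - ((num 40 - p) ² - N)) → NonNeg (l * u - n))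
      (hN : NonNeg (N - num 1600 * S)) where

      U-lower : NonNeg (l * U - n)
      U-lower = rescale U (core-lower-bound p N X Y p>0 p≤40 hp hN)

      V-lower : NonNeg (l * V - n)
      V-lower = rescale V (core-lower-bound p N Y X p>0 p≤40 hp
        (by hN (solve 3 (λ N X Y → N :- :num 1600 :* (X :² :+ Y :²) := N :- :num 1600 :* (Y :² :+ X :²)) refl N X Y)))

      UV-lower : NonNeg ((l * U) * (l * V) - n * n)
      UV-lower = *-mono n≥0 n≥0 U-lower V-lower

    UV₁ : NonNeg (num 128 - num 1600 * S) → NonNeg ((num 2 * U) * (num 2 * V) - num 5 * num 5)
    UV₁ = UV-lower (num 128) (num 6) (num 2) (num 5) (Pos-num 5) (difference≥0 34 6)
      (by (num≥0 16) (solve 0 (:num 16 := :num 4 :* :num 6 :² :- :num 128) refl)) (num≥0 5) rescale₁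

    UV₂ : NonNeg (num 256 - num 1600 * S) → NonNeg ((num 10 * U) * (num 10 * V) - num 19 * num 19)
    UV₂ = UV-lower (num 256) (num 8) (num 10) (num 19) (Pos-num 7) (difference≥0 32 8)
      (by (num≥0 0) (solve 0 (:num 0 := :num 4 :* :num 8 :² :- :num 256) refl)) (num≥0 19) rescale₂

    p₃ : NonNeg (num 4 * num 9 ² - num 320)
    p₃ = by (num≥0 4) (solve 0 (:num 4 := :num 4 :* :num 9 :² :- :num 320) refl)

    UV₃ : NonNeg ((num 2 * U) * (num 2 * V) - num 3 * num 3)
    UV₃ = UV-lower (num 320) (num 9) (num 2) (num 3) (Pos-num 8) (difference≥0 31 9) p₃ (num≥0 3) rescale₃ S≤1/5-scaled

    U≥0 : NonNeg U
    U≥0 = halve (U-lower (num 320) (num 9) (num 2) (num 3) (Pos-num 8) (difference≥0 31 9) p₃ (num≥0 3) rescale₃ S≤1/5-scaled)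

    V≥0 : NonNeg V
    V≥0 = halve (V-lower (num 320) (num 9) (num 2) (num 3) (Pos-num 8) (difference≥0 31 9) p₃ (num≥0 3) rescale₃ S≤1/5-scaled)

    per-lower : NonNeg ((num 8 * β) * (num 8 * δ) - (U * V - (ρ ² + num 2 * ε ²) * V - (ζ ² + num 2 * η ²) * U))
    per-lower = product-lower-bound U≥0 V≥0 (sq≥0 ρ ⊕ num≥0 2 ⊗ sq≥0 ε) (sq≥0 ζ ⊕ num≥0 2 ⊗ sq≥0 η) (num≥0 8 ⊗ β≥0) (num≥0 8 ⊗ δ≥0) hβ hδ

    two-variable : NonNeg (num 4 * (num 4 - X ²) ² + num 4 * (num 4 - Y ²) ² - num 122 - U * V)
    two-variable = by (num≥0 2 ⊗ h ⊕ per-lower ⊕ sq≥0 ρ ⊗ 4r'≥V ⊕ sq≥0 η ⊗ core-slack X Y ⊕ sq≥0 ε ⊗ core-slack Y X ⊕ sq≥0 ζ ⊗ 4k≥U)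
      (solve 10 (λ X Y ρ η ε ζ β δ U V →
          :num 2 :* (:num 2 :* (((:num 2 :- X) :² :- ρ :²) :* ((:num 2 :+ X) :² :- η :²) :+ ((:num 2 :- Y) :² :- ζ :²) :* ((:num 2 :+ Y) :² :- ε :²)) :- :num 32 :* (β :* δ) :- :num 61)
          :+ ((:num 8 :* β) :* (:num 8 :* δ) :- (U :* V :- (ρ :² :+ :num 2 :* ε :²) :* V :- (ζ :² :+ :num 2 :* η :²) :* U))
          :+ ρ :² :* (:num 4 :* ((:num 2 :+ X) :² :- η :²) :- V) :+ η :² :* (:num 4 :* (:num 2 :- X) :² :- :num 2 :* U)
          :+ ε :² :* (:num 4 :* (:num 2 :- Y) :² :- :num 2 :* V) :+ ζ :² :* (:num 4 :* ((:num 2 :+ Y) :² :- ε :²) :- U)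
        := :num 4 :* (:num 4 :- X :²) :² :+ :num 4 :* (:num 4 :- Y :²) :² :- :num 122 :- U :* V) refl X Y ρ η ε ζ β δ U V)

    -- S ≤ 1/5 absorbs the quartic terms, so UV ≤ 6 - 31.2 S. For S at least 0, 2/25 and 4/25 this
    -- is at most 6, 3.504 and 1.008, while `UV₁`, `UV₂` and `UV₃` give at least 6.25, 3.61 and
    -- 2.25.
    UV-upper : NonNeg (num 30 - num 156 * S - num 5 * (U * V))
    UV-upper = by (num≥0 5 ⊗ two-variable ⊕ num≥0 4 ⊗ (S≥0 ⊗ S≤1/5) ⊕ num≥0 40 ⊗ (sq≥0 X ⊗ sq≥0 Y))
      (solve 3 (λ X Y q → :num 5 :* (:num 4 :* (:num 4 :- X :²) :² :+ :num 4 :* (:num 4 :- Y :²) :² :- :num 122 :- q)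
          :+ :num 4 :* ((X :² :+ Y :²) :* (:num 1 :- :num 5 :* (X :² :+ Y :²))) :+ :num 40 :* (X :² :* Y :²)
        := :num 30 :- :num 156 :* (X :² :+ Y :²) :- :num 5 :* q) refl X Y (U * V))

    -- The upper and lower bounds for UV clash on each of S ≤ 2/25, 2/25 ≤ S ≤ 4/25, 4/25 ≤ S ≤ 1/5.
    impossible : ⊥
    impossible with ≤-total (num 25 * S) (num 2) | ≤-total (num 25 * S) (num 4)
    ... | inj₁ q | _ = negative-absurd 4 (by (num≥0 4 ⊗ UV-upper ⊕ num≥0 5 ⊗ UV₁ (by (num≥0 64 ⊗ ≤⇒NonNeg q)
          (solve 1 (λ S → :num 64 :* (:num 2 :- :num 25 :* S) := :num 128 :- :num 1600 :* S) refl S)) ⊕ num≥0 624 ⊗ S≥0)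
        (solve 3 (λ S U V → :num 4 :* (:num 30 :- :num 156 :* S :- :num 5 :* (U :* V)) :+ :num 5 :* ((:num 2 :* U) :* (:num 2 :* V) :- :num 5 :* :num 5) :+ :num 624 :* S := con -[1+ 4 ]) refl S U V))
    ... | inj₂ p | inj₁ q = negative-absurd 8 (by (num≥0 20 ⊗ UV-upper ⊕ UV₂ (by (num≥0 64 ⊗ ≤⇒NonNeg q)
          (solve 1 (λ S → :num 64 :* (:num 4 :- :num 25 :* S) := :num 256 :- :num 1600 :* S) refl S)) ⊕ num≥0 124 ⊗ ≤⇒NonNeg p ⊕ num≥0 20 ⊗ S≥0)
        (solve 3 (λ S U V → :num 20 :* (:num 30 :- :num 156 :* S :- :num 5 :* (U :* V)) :+ ((:num 10 :* U) :* (:num 10 :* V) :- :num 19 :* :num 19) :+ :num 124 :* (:num 25 :* S :- :num 2) :+ :num 20 :* S := con -[1+ 8 ]) refl S U V))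
    ... | inj₂ _ | inj₂ p = negative-absurd 20 (by (num≥0 4 ⊗ UV-upper ⊕ num≥0 5 ⊗ UV₃ ⊕ num≥0 24 ⊗ ≤⇒NonNeg p ⊕ num≥0 24 ⊗ S≥0)
        (solve 3 (λ S U V → :num 4 :* (:num 30 :- :num 156 :* S :- :num 5 :* (U :* V)) :+ :num 5 :* ((:num 2 :* U) :* (:num 2 :* V) :- :num 3 :* :num 3) :+ :num 24 :* (:num 25 :* S :- :num 4) :+ :num 24 :* S := con -[1+ 20 ]) refl S U V))

  -- Permanents of the blocks around a 2 × 2 zero block

  per₂ : ℝ → ℝ → ℝ → ℝ → ℝ
  per₂ x₁₁ x₁₂ x₂₁ x₂₂ = x₁₁ * x₂₂ + x₁₂ * x₂₁

  :per₂ : ∀ {k} → (x₁₁ x₁₂ x₂₁ x₂₂ : Polynomial k) → Polynomial k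
  :per₂ x₁₁ x₁₂ x₂₁ x₂₂ = x₁₁ :* x₂₂ :+ x₁₂ :* x₂₁

  -- e₁ and e₂ complete the column sums of the block to column sums of the whole matrix.  The
  -- source is 8 per₂ = (entry sum)² - (row difference)² - (column difference)² + (x₁₁ + x₂₂ - x₁₂ - x₂₁)².
  per₂-lower-bound : ∀ {x₁₁ x₁₂ x₂₁ x₂₂ e₁ e₂} X m → NonNeg e₁ → NonNeg e₂ →
    num 2 - X ≡ x₁₁ + x₁₂ + (x₂₁ + x₂₂) → m ≡ e₁ + e₂ →
    NonNeg (num 8 * per₂ x₁₁ x₁₂ x₂₁ x₂₂ - ((num 2 - X) ² - num 2 * m ² -
      ((x₁₁ + x₁₂ - (x₂₁ + x₂₂)) ² + num 2 * (x₁₁ + x₂₁ + e₁ - (x₁₂ + x₂₂ + e₂)) ²)))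
  per₂-lower-bound {x₁₁} {x₁₂} {x₂₁} {x₂₂} {e₁} {e₂} X m he₁ he₂ hX hm rewrite hX | hm =
    by (sq≥0 (x₁₁ + x₂₂ - x₁₂ - x₂₁) ⊕ sq≥0 (x₁₁ + x₂₁ + e₁ - (x₁₂ + x₂₂ + e₂) + (e₁ - e₂)) ⊕ num≥0 8 ⊗ (he₁ ⊗ he₂))
      (solve 6 (λ x₁₁ x₁₂ x₂₁ x₂₂ e₁ e₂ →
          (x₁₁ :+ x₂₂ :- x₁₂ :- x₂₁) :² :+ (x₁₁ :+ x₂₁ :+ e₁ :- (x₁₂ :+ x₂₂ :+ e₂) :+ (e₁ :- e₂)) :² :+ :num 8 :* (e₁ :* e₂)
        := :num 8 :* :per₂ x₁₁ x₁₂ x₂₁ x₂₂ :- ((x₁₁ :+ x₁₂ :+ (x₂₁ :+ x₂₂)) :² :- :num 2 :* (e₁ :+ e₂) :² :-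
             ((x₁₁ :+ x₁₂ :- (x₂₁ :+ x₂₂)) :² :+ :num 2 :* (x₁₁ :+ x₂₁ :+ e₁ :- (x₁₂ :+ x₂₂ :+ e₂)) :²)))
        refl x₁₁ x₁₂ x₂₁ x₂₂ e₁ e₂)

  4xy : ∀ x y → num 4 * (x * y) ≡ (x + y) ² - (x - y) ²
  4xy = solve 2 (λ x y → :num 4 :* (x :* y) := (x :+ y) :² :- (x :- y) :²) refl

  -- The matrix with 2 × 2 blocks 0, B in the top rows and D, E in the bottom rows; its permanent is β δ.
  module TwoByTwo
    (b₁₁ b₁₂ b₂₁ b₂₂ d₁₁ d₁₂ d₂₁ d₂₂ e₁₁ e₁₂ e₂₁ e₂₂ : ℝ) where

    r₁ = b₁₁ + b₁₂
    r₂ = b₂₁ + b₂₂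
    r₃ = d₁₁ + d₁₂ + (e₁₁ + e₁₂)
    r₄ = d₂₁ + d₂₂ + (e₂₁ + e₂₂)
    c₁ = d₁₁ + d₂₁
    c₂ = d₁₂ + d₂₂
    c₃ = b₁₁ + b₂₁ + (e₁₁ + e₂₁)
    c₄ = b₁₂ + b₂₂ + (e₁₂ + e₂₂)
    β = per₂ b₁₁ b₁₂ b₂₁ b₂₂
    -- D enters transposed, so that the completed sums in `per₂-lower-bound` become `r₃` and `r₄`.
    δ = per₂ d₁₁ d₂₁ d₁₂ d₂₂
    X = num 2 - (r₁ + r₂)
    Y = num 2 - (c₁ + c₂)

    module _
      (hb₁₁ : NonNeg b₁₁) (hb₁₂ : NonNeg b₁₂) (hb₂₁ : NonNeg b₂₁) (hb₂₂ : NonNeg b₂₂)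
      (hd₁₁ : NonNeg d₁₁) (hd₁₂ : NonNeg d₁₂) (hd₂₁ : NonNeg d₂₁) (hd₂₂ : NonNeg d₂₂)
      (he₁₁ : NonNeg e₁₁) (he₁₂ : NonNeg e₁₂) (he₂₁ : NonNeg e₂₁) (he₂₂ : NonNeg e₂₂)
      (total : r₁ + r₂ + (r₃ + r₄) ≡ num 4)
      (h : NonNeg (num 32 * (r₁ * r₂ * (r₃ * r₄) + c₁ * c₂ * (c₃ * c₄) - β * δ) - num 61)) where

      2-X : num 2 - X ≡ r₁ + r₂
      2-X = solve 1 (λ x → :num 2 :- (:num 2 :- x) := x) refl (r₁ + r₂)

      2-Y : num 2 - Y ≡ c₁ + c₂
      2-Y = solve 1 (λ x → :num 2 :- (:num 2 :- x) := x) refl (c₁ + c₂)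

      2+X : num 2 + X ≡ r₃ + r₄
      2+X = begin
        num 2 + (num 2 - (r₁ + r₂))        ≡⟨ solve 1 (λ x → :num 2 :+ (:num 2 :- x) := :num 4 :- x) refl (r₁ + r₂) ⟩
        num 4 - (r₁ + r₂)                  ≡⟨ cong (_- (r₁ + r₂)) (sym total) ⟩
        r₁ + r₂ + (r₃ + r₄) - (r₁ + r₂)    ≡⟨ solve 2 (λ x y → x :+ y :- x := y) refl (r₁ + r₂) (r₃ + r₄) ⟩
        r₃ + r₄                            ∎
        where open ≡-Reasoning

      total′ : c₁ + c₂ + (c₃ + c₄) ≡ num 4
      total′ = trans (solve 12 (λ b₁₁ b₁₂ b₂₁ b₂₂ d₁₁ d₁₂ d₂₁ d₂₂ e₁₁ e₁₂ e₂₁ e₂₂ →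
          d₁₁ :+ d₂₁ :+ (d₁₂ :+ d₂₂) :+ (b₁₁ :+ b₂₁ :+ (e₁₁ :+ e₂₁) :+ (b₁₂ :+ b₂₂ :+ (e₁₂ :+ e₂₂)))
          := b₁₁ :+ b₁₂ :+ (b₂₁ :+ b₂₂) :+ (d₁₁ :+ d₁₂ :+ (e₁₁ :+ e₁₂) :+ (d₂₁ :+ d₂₂ :+ (e₂₁ :+ e₂₂))))
        refl b₁₁ b₁₂ b₂₁ b₂₂ d₁₁ d₁₂ d₂₁ d₂₂ e₁₁ e₁₂ e₂₁ e₂₂) total

      2+Y : num 2 + Y ≡ c₃ + c₄
      2+Y = begin
        num 2 + (num 2 - (c₁ + c₂))        ≡⟨ solve 1 (λ x → :num 2 :+ (:num 2 :- x) := :num 4 :- x) refl (c₁ + c₂) ⟩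
        num 4 - (c₁ + c₂)                  ≡⟨ cong (_- (c₁ + c₂)) (sym total′) ⟩
        c₁ + c₂ + (c₃ + c₄) - (c₁ + c₂)    ≡⟨ solve 2 (λ x y → x :+ y :- x := y) refl (c₁ + c₂) (c₃ + c₄) ⟩
        c₃ + c₄                            ∎
        where open ≡-Reasoning

      X+Y : X + Y ≡ e₁₁ + e₂₁ + (e₁₂ + e₂₂)
      X+Y = begin
        X + (num 2 - (c₁ + c₂))                ≡⟨ solve 2 (λ x y → x :+ (:num 2 :- y) := :num 2 :+ x :- y) refl X (c₁ + c₂) ⟩
        num 2 + X - (c₁ + c₂)                  ≡⟨ cong (_- (c₁ + c₂)) 2+X ⟩
        r₃ + r₄ - (c₁ + c₂)                    ≡⟨ solve 8 (λ d₁₁ d₁₂ d₂₁ d₂₂ e₁₁ e₁₂ e₂₁ e₂₂ →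
                                                      d₁₁ :+ d₁₂ :+ (e₁₁ :+ e₁₂) :+ (d₂₁ :+ d₂₂ :+ (e₂₁ :+ e₂₂)) :- (d₁₁ :+ d₂₁ :+ (d₁₂ :+ d₂₂)) := e₁₁ :+ e₂₁ :+ (e₁₂ :+ e₂₂))
                                                      refl d₁₁ d₁₂ d₂₁ d₂₂ e₁₁ e₁₂ e₂₁ e₂₂ ⟩
        e₁₁ + e₂₁ + (e₁₂ + e₂₂)                ∎
        where open ≡-Reasoning

      Y+X : Y + X ≡ e₁₁ + e₁₂ + (e₂₁ + e₂₂)
      Y+X = trans (solve 2 (λ x y → y :+ x := x :+ y) refl X Y) (trans X+Y
        (solve 4 (λ e₁₁ e₁₂ e₂₁ e₂₂ → e₁₁ :+ e₂₁ :+ (e₁₂ :+ e₂₂) := e₁₁ :+ e₁₂ :+ (e₂₁ :+ e₂₂)) refl e₁₁ e₁₂ e₂₁ e₂₂))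

      4r₁r₂ : num 4 * (r₁ * r₂) ≡ minus-diff X (r₁ - r₂)
      4r₁r₂ = trans (4xy r₁ r₂) (cong (λ z → z ² - (r₁ - r₂) ²) (sym 2-X))
      4r₃r₄ : num 4 * (r₃ * r₄) ≡ plus-diff X (r₃ - r₄)
      4r₃r₄ = trans (4xy r₃ r₄) (cong (λ z → z ² - (r₃ - r₄) ²) (sym 2+X))
      4c₁c₂ : num 4 * (c₁ * c₂) ≡ minus-diff Y (c₁ - c₂)
      4c₁c₂ = trans (4xy c₁ c₂) (cong (λ z → z ² - (c₁ - c₂) ²) (sym 2-Y))
      4c₃c₄ : num 4 * (c₃ * c₄) ≡ plus-diff Y (c₃ - c₄)
      4c₃c₄ = trans (4xy c₃ c₄) (cong (λ z → z ² - (c₃ - c₄) ²) (sym 2+Y))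

      r₁≥0 = hb₁₁ ⊕ hb₁₂
      r₂≥0 = hb₂₁ ⊕ hb₂₂
      r₃≥0 = hd₁₁ ⊕ hd₁₂ ⊕ (he₁₁ ⊕ he₁₂)
      r₄≥0 = hd₂₁ ⊕ hd₂₂ ⊕ (he₂₁ ⊕ he₂₂)
      c₁≥0 = hd₁₁ ⊕ hd₂₁
      c₂≥0 = hd₁₂ ⊕ hd₂₂
      c₃≥0 = hb₁₁ ⊕ hb₂₁ ⊕ (he₁₁ ⊕ he₂₁)
      c₄≥0 = hb₁₂ ⊕ hb₂₂ ⊕ (he₁₂ ⊕ he₂₂)

      impossible : ⊥
      impossible = BlockBound.impossible X Y (r₁ - r₂) (r₃ - r₄) (c₃ - c₄) (c₁ - c₂) β δ
        (by (r₁≥0 ⊕ r₂≥0) (sym 2-X)) (by (r₃≥0 ⊕ r₄≥0) (sym 2+X))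
        (by (c₁≥0 ⊕ c₂≥0) (sym 2-Y)) (by (c₃≥0 ⊕ c₄≥0) (sym 2+Y))
        (by (num≥0 4 ⊗ (r₃≥0 ⊗ r₄≥0)) 4r₃r₄) (by (num≥0 4 ⊗ (c₃≥0 ⊗ c₄≥0)) 4c₃c₄)
        (hb₁₁ ⊗ hb₂₂ ⊕ hb₁₂ ⊗ hb₂₁) (hd₁₁ ⊗ hd₂₂ ⊕ hd₂₁ ⊗ hd₁₂)
        (per₂-lower-bound X (X + Y) (he₁₁ ⊕ he₂₁) (he₁₂ ⊕ he₂₂) 2-X X+Y)
        (per₂-lower-bound Y (Y + X) (he₁₁ ⊕ he₁₂) (he₂₁ ⊕ he₂₂) 2-Y Y+X)
        (by h (trans (solve 9 (λ r₁ r₂ r₃ r₄ c₁ c₂ c₃ c₄ q →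
            :num 32 :* (r₁ :* r₂ :* (r₃ :* r₄) :+ c₁ :* c₂ :* (c₃ :* c₄) :- q) :- :num 61
            := :num 2 :* (:num 4 :* (r₁ :* r₂) :* (:num 4 :* (r₃ :* r₄)) :+ :num 4 :* (c₁ :* c₂) :* (:num 4 :* (c₃ :* c₄))) :- :num 32 :* q :- :num 61)
            refl r₁ r₂ r₃ r₄ c₁ c₂ c₃ c₄ (β * δ))
          (cong₂ (λ x y → num 2 * (x + y) - num 32 * (β * δ) - num 61) (cong₂ _*_ 4r₁r₂ 4r₃r₄) (cong₂ _*_ 4c₁c₂ 4c₃c₄))))

  -- Test the hypothesis at τ = δ / (K + δ).
  linear-term-nonpos : ∀ δ K → NonNeg K →
    (∀ τ → NonNeg τ → NonNeg (num 1 - τ) → NonNeg (K * τ ² - τ * δ)) → ¬ Pos δ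
  linear-term-nonpos δ K K≥0 hyp δ>0 = Pos-* (Pos-* δ>0 δ>0) δ>0 (NonNeg⇒≤ δ³≤0)
    where
    N = K + δ
    N>0 : Pos N
    N>0 = Pos-mono δ>0 (by K≥0 (solve 2 (λ K δ → K := K :+ δ :- δ) refl K δ))
    N⁻¹ = inverse N (λ e → N>0 (subst (_≤ 0#) (sym e) (≤-refl 0#)))
    y = proj₁ N⁻¹
    Ny≡1 : N * y ≡ 1#
    Ny≡1 = proj₂ N⁻¹
    y≥0 : NonNeg y
    y≥0 = cancel-NonNeg N>0 (by (num≥0 1) (sym Ny≡1))
    τ≤1 : NonNeg (num 1 - δ * y)
    τ≤1 = by (K≥0 ⊗ y≥0) (trans (solve 3 (λ K δ y → K :* y := (K :+ δ) :* y :- δ :* y) refl K δ y) (cong (_- δ * y) Ny≡1))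
    δ³≤0 : NonNeg (0# - δ * δ * δ)
    δ³≤0 = by (sq≥0 N ⊗ hyp (δ * y) (Pos⇒NonNeg δ>0 ⊗ y≥0) τ≤1) (begin
      N ² * (K * (δ * y) ² - δ * y * δ)               ≡⟨ solve 4 (λ N K δ y → N :² :* (K :* (δ :* y) :² :- δ :* y :* δ)
                                                            := K :* δ :² :* (N :* y) :² :- N :* δ :² :* (N :* y)) refl N K δ y ⟩
      K * δ ² * (N * y) ² - N * δ ² * (N * y)         ≡⟨ cong (λ z → K * δ ² * z ² - N * δ ² * z) Ny≡1 ⟩
      K * δ ² * 1# ² - N * δ ² * 1#                   ≡⟨ solve 2 (λ K δ → K :* δ :² :* :num 1 :² :- (K :+ δ) :* δ :² :* :num 1
                                                            := :num 0 :- δ :* δ :* δ) refl K δ ⟩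
      0# - δ * δ * δ                                  ∎)
      where open ≡-Reasoning

  -- Consequences of the arithmetic-geometric mean inequality

  module FourNumbers (x y z t : ℝ) (hx : NonNeg x) (hy : NonNeg y) (hz : NonNeg z) (ht : NonNeg t)
    (sum : x + y + (z + t) ≡ num 4) where

    u = x + y
    f = u * (z + t)

    z+t : z + t ≡ num 4 - u
    z+t = trans (solve 2 (λ u v → v := u :+ v :- u) refl u (z + t)) (cong (_- u) sum)

    f≡ : f ≡ u * (num 4 - u)
    f≡ = cong (u *_) z+t

    f≥0 : NonNeg f
    f≥0 = (hx ⊕ hy) ⊗ (hz ⊕ ht)

    f²≥ : NonNeg (f ² - num 16 * (x * y * (z * t)))
    f²≥ = by (*-mono (num≥0 4 ⊗ (hx ⊗ hy)) (num≥0 4 ⊗ (hz ⊗ ht)) (square x y) (square z t))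
      (solve 4 (λ x y z t → (x :+ y) :² :* (z :+ t) :² :- :num 4 :* (x :* y) :* (:num 4 :* (z :* t))
        := ((x :+ y) :* (z :+ t)) :² :- :num 16 :* (x :* y :* (z :* t))) refl x y z t)
      where
      square : ∀ x y → NonNeg ((x + y) ² - num 4 * (x * y))
      square x y = by (sq≥0 (x - y)) (solve 2 (λ x y → (x :- y) :² := (x :+ y) :² :- :num 4 :* (x :* y)) refl x y)

    product≤1 : NonNeg (num 1 - x * y * (z * t))
    product≤1 = cancel-NonNeg (Pos-num 15) (by (4-f ⊗ (4-f ⊕ f≥0 ⊕ f≥0) ⊕ f²≥)
      (solve 2 (λ f q → (:num 4 :- f) :* (:num 4 :- f :+ f :+ f) :+ (f :² :- :num 16 :* q) := :num 16 :* (:num 1 :- q)) refl f (x * y * (z * t))))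
      where
      4-f : NonNeg (num 4 - f)
      4-f = by (sq≥0 (u - num 2)) (trans (solve 1 (λ u → (u :- :num 2) :² := :num 4 :- u :* (:num 4 :- u)) refl u) (cong (λ z → num 4 - z) (sym f≡)))

    -- Since (u - 2)² = 4 - f, a lower bound for f bounds u from above. The hypothesis gives 2f² ≥
    -- 29, hence f ≥ 15/4, because 225/16 is below 29/2.
    pair≤5/2 : NonNeg (num 32 * (x * y * (z * t)) - num 29) → NonNeg (num 5 - num 2 * (x + y))
    pair≤5/2 h = by (sq-bound (num 1) (num 2 * (u - num 2)) Pos-1 (by 4f≥15 (trans (cong (λ f → num 4 * f - num 15) f≡)
        (solve 1 (λ u → :num 4 :* (u :* (:num 4 :- u)) :- :num 15 := :num 1 :² :- (:num 2 :* (u :- :num 2)) :²) refl u))))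
      (solve 1 (λ u → :num 1 :- :num 2 :* (u :- :num 2) := :num 5 :- :num 2 :* u) refl u)
      where
      2f²≥29 : NonNeg (num 2 * f ² - num 29)
      2f²≥29 = by (num≥0 2 ⊗ f²≥ ⊕ h) (solve 2 (λ f q → :num 2 :* (f :² :- :num 16 :* q) :+ (:num 32 :* q :- :num 29) := :num 2 :* f :² :- :num 29) refl f (x * y * (z * t)))
      4f≥15 : NonNeg (num 4 * f - num 15)
      4f≥15 with ≤-total (num 15) (num 4 * f)
      ... | inj₁ p = ≤⇒NonNeg p
      ... | inj₂ p = ⊥-elim (negative-absurd 6 (by (num≥0 8 ⊗ 2f²≥29 ⊕ sq-mono (num≥0 4 ⊗ f≥0) (≤⇒NonNeg p))
        (solve 1 (λ f → :num 8 :* (:num 2 :* f :² :- :num 29) :+ (:num 15 :² :- (:num 4 :* f) :²) := con -[1+ 6 ]) refl f)))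

  am-gm₃ : ∀ {x y z} → NonNeg x → NonNeg y → NonNeg z → NonNeg ((x + y + z) * (x + y + z) ² - num 27 * (x * y * z))
  am-gm₃ {x} {y} {z} hx hy hz = cancel-NonNeg (Pos-num 1)
    (by ((hx ⊕ hy ⊕ hz) ⊗ (sq≥0 (x - y) ⊕ sq≥0 (y - z) ⊕ sq≥0 (z - x))
        ⊕ num≥0 6 ⊗ (hx ⊗ sq≥0 (y - z) ⊕ hy ⊗ sq≥0 (z - x) ⊕ hz ⊗ sq≥0 (x - y)))
      (solve 3 (λ x y z → (x :+ y :+ z) :* ((x :- y) :² :+ (y :- z) :² :+ (z :- x) :²)
          :+ :num 6 :* (x :* (y :- z) :² :+ y :* (z :- x) :² :+ z :* (x :- y) :²)
        := :num 2 :* ((x :+ y :+ z) :* (x :+ y :+ z) :² :- :num 27 :* (x :* y :* z))) refl x y z))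

  -- Estimates for a top row with three zeros

  per₃ : (x₁₁ x₁₂ x₁₃ x₂₁ x₂₂ x₂₃ x₃₁ x₃₂ x₃₃ : ℝ) → ℝ
  per₃ x₁₁ x₁₂ x₁₃ x₂₁ x₂₂ x₂₃ x₃₁ x₃₂ x₃₃ =
    x₁₁ * per₂ x₂₂ x₂₃ x₃₂ x₃₃ + x₁₂ * per₂ x₂₁ x₂₃ x₃₁ x₃₃ + x₁₃ * per₂ x₂₁ x₂₂ x₃₁ x₃₂

  :per₃ : ∀ {k} → (x₁₁ x₁₂ x₁₃ x₂₁ x₂₂ x₂₃ x₃₁ x₃₂ x₃₃ : Polynomial k) → Polynomial k
  :per₃ x₁₁ x₁₂ x₁₃ x₂₁ x₂₂ x₂₃ x₃₁ x₃₂ x₃₃ =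
    x₁₁ :* :per₂ x₂₂ x₂₃ x₃₂ x₃₃ :+ x₁₂ :* :per₂ x₂₁ x₂₃ x₃₁ x₃₃ :+ x₁₃ :* :per₂ x₂₁ x₂₂ x₃₁ x₃₂

  mix : (u₁ u₂ u₃ v₁ v₂ v₃ : ℝ) → ℝ
  mix u₁ u₂ u₃ v₁ v₂ v₃ = per₃ u₁ u₂ u₃ u₁ u₂ u₃ v₁ v₂ v₃ + per₃ v₁ v₂ v₃ v₁ v₂ v₃ u₁ u₂ u₃

  :mix : ∀ {k} → (u₁ u₂ u₃ v₁ v₂ v₃ : Polynomial k) → Polynomial k
  :mix u₁ u₂ u₃ v₁ v₂ v₃ = :per₃ u₁ u₂ u₃ u₁ u₂ u₃ v₁ v₂ v₃ :+ :per₃ v₁ v₂ v₃ v₁ v₂ v₃ u₁ u₂ u₃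

  -- mix is 2 (∏ (uⱼ + vⱼ) - ∏ uⱼ - ∏ vⱼ).
  mix≤7/6 : ∀ {u₁ u₂ u₃ v₁ v₂ v₃} → NonNeg u₁ → NonNeg u₂ → NonNeg u₃ → NonNeg v₁ → NonNeg v₂ → NonNeg v₃ →
    NonNeg (num 5 - num 2 * (u₁ + v₁ + (u₂ + v₂) + (u₃ + v₃))) → NonNeg (num 7 - num 6 * mix u₁ u₂ u₃ v₁ v₂ v₃)
  mix≤7/6 {u₁} {u₂} {u₃} {v₁} {v₂} {v₃} hu₁ hu₂ hu₃ hv₁ hv₂ hv₃ h =
    by (7≥12∏ ⊕ num≥0 12 ⊗ (hu₁ ⊗ hu₂ ⊗ hu₃ ⊕ hv₁ ⊗ hv₂ ⊗ hv₃))
      (solve 6 (λ u₁ u₂ u₃ v₁ v₂ v₃ → :num 7 :- :num 12 :* ((u₁ :+ v₁) :* (u₂ :+ v₂) :* (u₃ :+ v₃)) :+ :num 12 :* (u₁ :* u₂ :* u₃ :+ v₁ :* v₂ :* v₃)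
        := :num 7 :- :num 6 :* :mix u₁ u₂ u₃ v₁ v₂ v₃) refl u₁ u₂ u₃ v₁ v₂ v₃)
    where
    σ = u₁ + v₁ + (u₂ + v₂) + (u₃ + v₃)
    σ≥0 : NonNeg σ
    σ≥0 = hu₁ ⊕ hv₁ ⊕ (hu₂ ⊕ hv₂) ⊕ (hu₃ ⊕ hv₃)
    7≥12∏ : NonNeg (num 7 - num 12 * ((u₁ + v₁) * (u₂ + v₂) * (u₃ + v₃)))
    7≥12∏ = cancel-NonNeg (Pos-num 17)
      (by (num≥0 8 ⊗ am-gm₃ (hu₁ ⊕ hv₁) (hu₂ ⊕ hv₂) (hu₃ ⊕ hv₃) ⊕ h ⊗ (num≥0 25 ⊕ num≥0 10 ⊗ σ≥0 ⊕ num≥0 4 ⊗ sq≥0 σ) ⊕ num≥0 1)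
        (solve 2 (λ σ q → :num 8 :* (σ :* σ :² :- :num 27 :* q) :+ (:num 5 :- :num 2 :* σ) :* (:num 25 :+ :num 10 :* σ :+ :num 4 :* σ :²) :+ :num 1
          := :num 18 :* (:num 7 :- :num 12 :* q)) refl σ ((u₁ + v₁) * (u₂ + v₂) * (u₃ + v₃))))

  -- The matrix with top row (0, 0, 0, a) and the rows (dᵢ₁, dᵢ₂, dᵢ₃, eᵢ) below it.  The qⱼ and p are the
  -- permanental minors of the top row, so that φ = a P + C k - a p.
  module RowCase (a d₁₁ d₁₂ d₁₃ d₂₁ d₂₂ d₂₃ d₃₁ d₃₂ d₃₃ e₁ e₂ e₃ : ℝ) where

    r₁ = d₁₁ + d₁₂ + d₁₃ + e₁
    r₂ = d₂₁ + d₂₂ + d₂₃ + e₂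
    r₃ = d₃₁ + d₃₂ + d₃₃ + e₃
    g₁ = d₁₁ + d₂₁ + d₃₁
    g₂ = d₁₂ + d₂₂ + d₃₂
    g₃ = d₁₃ + d₂₃ + d₃₃
    w = e₁ + e₂ + e₃
    k = a + w
    P = r₁ * r₂ * r₃
    C = g₁ * g₂ * g₃
    p = per₃ d₁₁ d₁₂ d₁₃ d₂₁ d₂₂ d₂₃ d₃₁ d₃₂ d₃₃
    q₁ = per₃ d₁₂ d₁₃ e₁ d₂₂ d₂₃ e₂ d₃₂ d₃₃ e₃
    q₂ = per₃ d₁₁ d₁₃ e₁ d₂₁ d₂₃ e₂ d₃₁ d₃₃ e₃
    q₃ = per₃ d₁₁ d₁₂ e₁ d₂₁ d₂₂ e₂ d₃₁ d₃₂ e₃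
    m₁ = mix d₂₁ d₂₂ d₂₃ d₃₁ d₃₂ d₃₃
    m₂ = mix d₁₁ d₁₂ d₁₃ d₃₁ d₃₂ d₃₃
    m₃ = mix d₁₁ d₁₂ d₁₃ d₂₁ d₂₂ d₂₃

    -- Expand each `qⱼ` along the column e. The coefficient of `eᵢ` becomes the sum over l of the
    -- permanents of D with row i replaced by row l: l = i gives `p`, and the other two rows give
    -- `mᵢ`.
    weighted-minors : g₁ * q₁ + g₂ * q₂ + g₃ * q₃ ≡ w * p + (e₁ * m₁ + e₂ * m₂ + e₃ * m₃)
    weighted-minors = solve 12 (λ d₁₁ d₁₂ d₁₃ d₂₁ d₂₂ d₂₃ d₃₁ d₃₂ d₃₃ e₁ e₂ e₃ →
        (d₁₁ :+ d₂₁ :+ d₃₁) :* :per₃ d₁₂ d₁₃ e₁ d₂₂ d₂₃ e₂ d₃₂ d₃₃ e₃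
        :+ (d₁₂ :+ d₂₂ :+ d₃₂) :* :per₃ d₁₁ d₁₃ e₁ d₂₁ d₂₃ e₂ d₃₁ d₃₃ e₃
        :+ (d₁₃ :+ d₂₃ :+ d₃₃) :* :per₃ d₁₁ d₁₂ e₁ d₂₁ d₂₂ e₂ d₃₁ d₃₂ e₃
      := (e₁ :+ e₂ :+ e₃) :* :per₃ d₁₁ d₁₂ d₁₃ d₂₁ d₂₂ d₂₃ d₃₁ d₃₂ d₃₃
        :+ (e₁ :* :mix d₂₁ d₂₂ d₂₃ d₃₁ d₃₂ d₃₃ :+ e₂ :* :mix d₁₁ d₁₂ d₁₃ d₃₁ d₃₂ d₃₃ :+ e₃ :* :mix d₁₁ d₁₂ d₁₃ d₂₁ d₂₂ d₂₃))
      refl d₁₁ d₁₂ d₁₃ d₂₁ d₂₂ d₂₃ d₃₁ d₃₂ d₃₃ e₁ e₂ e₃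

    module Bounds (ha : NonNeg a)
      (hd₁₁ : NonNeg d₁₁) (hd₁₂ : NonNeg d₁₂) (hd₁₃ : NonNeg d₁₃)
      (hd₂₁ : NonNeg d₂₁) (hd₂₂ : NonNeg d₂₂) (hd₂₃ : NonNeg d₂₃)
      (hd₃₁ : NonNeg d₃₁) (hd₃₂ : NonNeg d₃₂) (hd₃₃ : NonNeg d₃₃)
      (he₁ : NonNeg e₁) (he₂ : NonNeg e₂) (he₃ : NonNeg e₃)
      (total : a + r₁ + (r₂ + r₃) ≡ num 4)
      (h : NonNeg (num 32 * (a * P + C * k - a * p) - num 61)) where

      r₁≥0 = hd₁₁ ⊕ hd₁₂ ⊕ hd₁₃ ⊕ he₁
      r₂≥0 = hd₂₁ ⊕ hd₂₂ ⊕ hd₂₃ ⊕ he₂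
      r₃≥0 = hd₃₁ ⊕ hd₃₂ ⊕ hd₃₃ ⊕ he₃
      g₁≥0 = hd₁₁ ⊕ hd₂₁ ⊕ hd₃₁
      g₂≥0 = hd₁₂ ⊕ hd₂₂ ⊕ hd₃₂
      g₃≥0 = hd₁₃ ⊕ hd₂₃ ⊕ hd₃₃
      w≥0 = he₁ ⊕ he₂ ⊕ he₃
      k≥0 = ha ⊕ w≥0

      p≥0 : NonNeg p
      p≥0 = hd₁₁ ⊗ (hd₂₂ ⊗ hd₃₃ ⊕ hd₂₃ ⊗ hd₃₂) ⊕ hd₁₂ ⊗ (hd₂₁ ⊗ hd₃₃ ⊕ hd₂₃ ⊗ hd₃₁) ⊕ hd₁₃ ⊗ (hd₂₁ ⊗ hd₃₂ ⊕ hd₂₂ ⊗ hd₃₁)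

      total′ : k + g₁ + (g₂ + g₃) ≡ num 4
      total′ = trans (solve 13 (λ a d₁₁ d₁₂ d₁₃ d₂₁ d₂₂ d₂₃ d₃₁ d₃₂ d₃₃ e₁ e₂ e₃ →
          a :+ (e₁ :+ e₂ :+ e₃) :+ (d₁₁ :+ d₂₁ :+ d₃₁) :+ (d₁₂ :+ d₂₂ :+ d₃₂ :+ (d₁₃ :+ d₂₃ :+ d₃₃))
          := a :+ (d₁₁ :+ d₁₂ :+ d₁₃ :+ e₁) :+ (d₂₁ :+ d₂₂ :+ d₂₃ :+ e₂ :+ (d₃₁ :+ d₃₂ :+ d₃₃ :+ e₃)))
        refl a d₁₁ d₁₂ d₁₃ d₂₁ d₂₂ d₂₃ d₃₁ d₃₂ d₃₃ e₁ e₂ e₃) total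

      rows≤1 : NonNeg (num 1 - a * r₁ * (r₂ * r₃))
      rows≤1 = FourNumbers.product≤1 a r₁ r₂ r₃ ha r₁≥0 r₂≥0 r₃≥0 total

      cols≤1 : NonNeg (num 1 - k * g₁ * (g₂ * g₃))
      cols≤1 = FourNumbers.product≤1 k g₁ g₂ g₃ k≥0 g₁≥0 g₂≥0 g₃≥0 total′

      aQ≥29/32 : NonNeg (num 32 * (a * (P - p)) - num 29)
      aQ≥29/32 = by (h ⊕ num≥0 32 ⊗ cols≤1)
        (solve 7 (λ a P k p g₁ g₂ g₃ → :num 32 :* (a :* P :+ g₁ :* g₂ :* g₃ :* k :- a :* p) :- :num 61 :+ :num 32 :* (:num 1 :- k :* g₁ :* (g₂ :* g₃))
          := :num 32 :* (a :* (P :- p)) :- :num 29) refl a P k p g₁ g₂ g₃)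

      rows≥29/32 : NonNeg (num 32 * (a * P) - num 29)
      rows≥29/32 = by (aQ≥29/32 ⊕ num≥0 32 ⊗ (ha ⊗ p≥0))
        (solve 3 (λ a P p → :num 32 :* (a :* (P :- p)) :- :num 29 :+ :num 32 :* (a :* p) := :num 32 :* (a :* P) :- :num 29) refl a P p)

      cols≥29/32 : NonNeg (num 32 * (k * C) - num 29)
      cols≥29/32 = by (h ⊕ num≥0 32 ⊗ rows≤1 ⊕ num≥0 32 ⊗ (ha ⊗ p≥0))
        (solve 7 (λ a r₁ r₂ r₃ k C p → :num 32 :* (a :* (r₁ :* r₂ :* r₃) :+ C :* k :- a :* p) :- :num 61 :+ :num 32 :* (:num 1 :- a :* r₁ :* (r₂ :* r₃)) :+ :num 32 :* (a :* p)
          := :num 32 :* (k :* C) :- :num 29) refl a r₁ r₂ r₃ k C p)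

      r₂+r₃ : NonNeg (num 5 - num 2 * (r₂ + r₃))
      r₂+r₃ = FourNumbers.pair≤5/2 r₂ r₃ a r₁ r₂≥0 r₃≥0 ha r₁≥0
        (trans (solve 4 (λ a x y z → y :+ z :+ (a :+ x) := a :+ x :+ (y :+ z)) refl a r₁ r₂ r₃) total)
        (by rows≥29/32 (solve 4 (λ a x y z → :num 32 :* (a :* (x :* y :* z)) :- :num 29 := :num 32 :* (y :* z :* (a :* x)) :- :num 29) refl a r₁ r₂ r₃))

      r₁+r₃ : NonNeg (num 5 - num 2 * (r₁ + r₃))
      r₁+r₃ = FourNumbers.pair≤5/2 r₁ r₃ a r₂ r₁≥0 r₃≥0 ha r₂≥0
        (trans (solve 4 (λ a x y z → x :+ z :+ (a :+ y) := a :+ x :+ (y :+ z)) refl a r₁ r₂ r₃) total)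
        (by rows≥29/32 (solve 4 (λ a x y z → :num 32 :* (a :* (x :* y :* z)) :- :num 29 := :num 32 :* (x :* z :* (a :* y)) :- :num 29) refl a r₁ r₂ r₃))

      r₁+r₂ : NonNeg (num 5 - num 2 * (r₁ + r₂))
      r₁+r₂ = FourNumbers.pair≤5/2 r₁ r₂ a r₃ r₁≥0 r₂≥0 ha r₃≥0
        (trans (solve 4 (λ a x y z → x :+ y :+ (a :+ z) := a :+ x :+ (y :+ z)) refl a r₁ r₂ r₃) total)
        (by rows≥29/32 (solve 4 (λ a x y z → :num 32 :* (a :* (x :* y :* z)) :- :num 29 := :num 32 :* (x :* y :* (a :* z)) :- :num 29) refl a r₁ r₂ r₃))

      k+g₁ : NonNeg (num 5 - num 2 * (k + g₁))
      k+g₁ = FourNumbers.pair≤5/2 k g₁ g₂ g₃ k≥0 g₁≥0 g₂≥0 g₃≥0 total′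
        (by cols≥29/32 (solve 4 (λ a x y z → :num 32 :* (a :* (x :* y :* z)) :- :num 29 := :num 32 :* (a :* x :* (y :* z)) :- :num 29) refl k g₁ g₂ g₃))

      k+g₂ : NonNeg (num 5 - num 2 * (k + g₂))
      k+g₂ = FourNumbers.pair≤5/2 k g₂ g₁ g₃ k≥0 g₂≥0 g₁≥0 g₃≥0
        (trans (solve 4 (λ a x y z → a :+ y :+ (x :+ z) := a :+ x :+ (y :+ z)) refl k g₁ g₂ g₃) total′)
        (by cols≥29/32 (solve 4 (λ a x y z → :num 32 :* (a :* (x :* y :* z)) :- :num 29 := :num 32 :* (a :* y :* (x :* z)) :- :num 29) refl k g₁ g₂ g₃))

      k+g₃ : NonNeg (num 5 - num 2 * (k + g₃))
      k+g₃ = FourNumbers.pair≤5/2 k g₃ g₁ g₂ k≥0 g₃≥0 g₁≥0 g₂≥0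
        (trans (solve 4 (λ a x y z → a :+ z :+ (x :+ y) := a :+ x :+ (y :+ z)) refl k g₁ g₂ g₃) total′)
        (by cols≥29/32 (solve 4 (λ a x y z → :num 32 :* (a :* (x :* y :* z)) :- :num 29 := :num 32 :* (a :* z :* (x :* y)) :- :num 29) refl k g₁ g₂ g₃))

      -- Adding the three pair bounds counts `k` three times and every other column once, so 2k + 4
      -- ≤ 15/2.
      k≤7/4 : NonNeg (num 7 - num 4 * k)
      k≤7/4 = by (k+g₁ ⊕ k+g₂ ⊕ k+g₃) (begin
        num 5 - num 2 * (k + g₁) + (num 5 - num 2 * (k + g₂)) + (num 5 - num 2 * (k + g₃))
          ≡⟨ solve 4 (λ k x y z → :num 5 :- :num 2 :* (k :+ x) :+ (:num 5 :- :num 2 :* (k :+ y)) :+ (:num 5 :- :num 2 :* (k :+ z))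
               := :num 15 :- :num 4 :* k :- :num 2 :* (k :+ x :+ (y :+ z))) refl k g₁ g₂ g₃ ⟩
        num 15 - num 4 * k - num 2 * (k + g₁ + (g₂ + g₃))
          ≡⟨ cong (λ s → num 15 - num 4 * k - num 2 * s) total′ ⟩
        num 15 - num 4 * k - num 2 * num 4
          ≡⟨ solve 1 (λ k → :num 15 :- :num 4 :* k :- :num 2 :* :num 4 := :num 7 :- :num 4 :* k) refl k ⟩
        num 7 - num 4 * k ∎)
        where open ≡-Reasoning

      C≥0 : NonNeg C
      C≥0 = g₁≥0 ⊗ g₂≥0 ⊗ g₃≥0

      C≥1/2 : NonNeg (num 2 * C - num 1)
      C≥1/2 = cancel-NonNeg (Pos-num 27) (by (cols≥29/32 ⊕ num≥0 8 ⊗ (C≥0 ⊗ k≤7/4) ⊕ num≥0 1)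
        (solve 2 (λ k C → :num 32 :* (k :* C) :- :num 29 :+ :num 8 :* (C :* (:num 7 :- :num 4 :* k)) :+ :num 1 := :num 28 :* (:num 2 :* C :- :num 1)) refl k C))

      C>0 : Pos C
      C>0 C≤0 = negative-absurd 0 (by (C≥1/2 ⊕ num≥0 2 ⊗ ≤⇒NonNeg C≤0)
        (solve 1 (λ C → :num 2 :* C :- :num 1 :+ :num 2 :* (:num 0 :- C) := con -[1+ 0 ]) refl C))

      block-sum : ∀ u₁ u₂ u₃ u₄ v₁ v₂ v₃ v₄ → NonNeg u₄ → NonNeg v₄ →
        NonNeg (num 5 - num 2 * (u₁ + u₂ + u₃ + u₄ + (v₁ + v₂ + v₃ + v₄))) →
        NonNeg (num 5 - num 2 * (u₁ + v₁ + (u₂ + v₂) + (u₃ + v₃)))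
      block-sum u₁ u₂ u₃ u₄ v₁ v₂ v₃ v₄ hu hv q = by (q ⊕ num≥0 2 ⊗ (hu ⊕ hv))
        (solve 8 (λ u₁ u₂ u₃ u₄ v₁ v₂ v₃ v₄ → :num 5 :- :num 2 :* (u₁ :+ u₂ :+ u₃ :+ u₄ :+ (v₁ :+ v₂ :+ v₃ :+ v₄)) :+ :num 2 :* (u₄ :+ v₄)
          := :num 5 :- :num 2 :* (u₁ :+ v₁ :+ (u₂ :+ v₂) :+ (u₃ :+ v₃))) refl u₁ u₂ u₃ u₄ v₁ v₂ v₃ v₄)

      -- Two rows sum to at most 5/2, so the product of the three column totals is at most (5/6)³
      -- and `m₁` at most 125/108, just below 7/6.
      m₁≤7/6 : NonNeg (num 7 - num 6 * m₁)
      m₁≤7/6 = mix≤7/6 hd₂₁ hd₂₂ hd₂₃ hd₃₁ hd₃₂ hd₃₃ (block-sum d₂₁ d₂₂ d₂₃ e₂ d₃₁ d₃₂ d₃₃ e₃ he₂ he₃ r₂+r₃)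
      m₂≤7/6 : NonNeg (num 7 - num 6 * m₂)
      m₂≤7/6 = mix≤7/6 hd₁₁ hd₁₂ hd₁₃ hd₃₁ hd₃₂ hd₃₃ (block-sum d₁₁ d₁₂ d₁₃ e₁ d₃₁ d₃₂ d₃₃ e₃ he₁ he₃ r₁+r₃)
      m₃≤7/6 : NonNeg (num 7 - num 6 * m₃)
      m₃≤7/6 = mix≤7/6 hd₁₁ hd₁₂ hd₁₃ hd₂₁ hd₂₂ hd₂₃ (block-sum d₁₁ d₁₂ d₁₃ e₁ d₂₁ d₂₂ d₂₃ e₂ he₁ he₂ r₁+r₂)

      g-sum : g₁ + g₂ + g₃ ≡ num 4 - k
      g-sum = trans (solve 4 (λ k x y z → x :+ y :+ z := k :+ x :+ (y :+ z) :- k) refl k g₁ g₂ g₃) (cong (_- k) total′)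

      P≥0 : NonNeg P
      P≥0 = r₁≥0 ⊗ r₂≥0 ⊗ r₃≥0

      a>0 : Pos a
      a>0 a≤0 = negative-absurd 28 (by (rows≥29/32 ⊕ num≥0 32 ⊗ (≤⇒NonNeg a≤0 ⊗ P≥0))
        (solve 2 (λ a P → :num 32 :* (a :* P) :- :num 29 :+ :num 32 :* ((:num 0 :- a) :* P) := con -[1+ 28 ]) refl a P))

      φ≥0 : NonNeg (a * P + C * k - a * p)
      φ≥0 = cancel-NonNeg (Pos-num 31) (by (h ⊕ num≥0 61)
        (solve 1 (λ x → :num 32 :* x :- :num 61 :+ :num 61 := :num 32 :* x) refl (a * P + C * k - a * p)))

      -- First-order conditions at a maximum: corner compares ∂φ/∂x₀₃ with φ (Euler's relation
      -- for the homogeneous φ), and moveⱼ compares ∂φ/∂x₀ⱼ with ∂φ/∂x₀₃.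
      module Stationary
        (corner : P + C - p - (a * P + C * k - a * p) ≤ 0#)
        (move₁ : k * (g₂ * g₃) - C - q₁ + p ≤ 0#)
        (move₂ : k * (g₁ * g₃) - C - q₂ + p ≤ 0#)
        (move₃ : k * (g₁ * g₂) - C - q₃ + p ≤ 0#) where

        -- Sum of the moveⱼ weighted by the column sums gⱼ.
        moves : NonNeg (w * p + (e₁ * m₁ + e₂ * m₂ + e₃ * m₃) + (num 4 - k) * (C - p) - num 3 * (k * C))
        moves = by (g₁≥0 ⊗ ≤⇒NonNeg move₁ ⊕ g₂≥0 ⊗ ≤⇒NonNeg move₂ ⊕ g₃≥0 ⊗ ≤⇒NonNeg move₃) (begin
          g₁ * (0# - (k * (g₂ * g₃) - C - q₁ + p)) + g₂ * (0# - (k * (g₁ * g₃) - C - q₂ + p)) + g₃ * (0# - (k * (g₁ * g₂) - C - q₃ + p))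
            ≡⟨ solve 8 (λ g₁ g₂ g₃ q₁ q₂ q₃ p k → let C = g₁ :* g₂ :* g₃ in
                 g₁ :* (:num 0 :- (k :* (g₂ :* g₃) :- C :- q₁ :+ p)) :+ g₂ :* (:num 0 :- (k :* (g₁ :* g₃) :- C :- q₂ :+ p)) :+ g₃ :* (:num 0 :- (k :* (g₁ :* g₂) :- C :- q₃ :+ p))
                 := g₁ :* q₁ :+ g₂ :* q₂ :+ g₃ :* q₃ :+ (g₁ :+ g₂ :+ g₃) :* (C :- p) :- :num 3 :* (k :* C)) refl g₁ g₂ g₃ q₁ q₂ q₃ p k ⟩
          g₁ * q₁ + g₂ * q₂ + g₃ * q₃ + (g₁ + g₂ + g₃) * (C - p) - num 3 * (k * C)
            ≡⟨ cong₂ (λ x s → x + s * (C - p) - num 3 * (k * C)) weighted-minors g-sum ⟩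
          w * p + (e₁ * m₁ + e₂ * m₂ + e₃ * m₃) + (num 4 - k) * (C - p) - num 3 * (k * C) ∎)
          where open ≡-Reasoning

        z = k - num 1

        -- In six times `moves` the `mᵢ` contribute at most 7w, and the coefficient of `p` is 6w +
        -- 6k - 24 = 12k - 6a - 24, at most -3 because k ≤ 7/4.
        moves′ : NonNeg (num 7 * w - num 24 * (z * C) - num 3 * p)
        moves′ = by (num≥0 6 ⊗ moves ⊕ (he₁ ⊗ m₁≤7/6 ⊕ he₂ ⊗ m₂≤7/6 ⊕ he₃ ⊗ m₃≤7/6) ⊕ p≥0 ⊗ (num≥0 3 ⊗ k≤7/4 ⊕ num≥0 6 ⊗ ha))
          (solve 9 (λ a e₁ e₂ e₃ m₁ m₂ m₃ p C → let w = e₁ :+ e₂ :+ e₃; k = a :+ w in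
            :num 6 :* (w :* p :+ (e₁ :* m₁ :+ e₂ :* m₂ :+ e₃ :* m₃) :+ (:num 4 :- k) :* (C :- p) :- :num 3 :* (k :* C))
            :+ (e₁ :* (:num 7 :- :num 6 :* m₁) :+ e₂ :* (:num 7 :- :num 6 :* m₂) :+ e₃ :* (:num 7 :- :num 6 :* m₃))
            :+ p :* (:num 3 :* (:num 7 :- :num 4 :* k) :+ :num 6 :* a)
            := :num 7 :* w :- :num 24 :* ((k :- :num 1) :* C) :- :num 3 :* p) refl a e₁ e₂ e₃ m₁ m₂ m₃ p C)

        Q = P - p

        corner′ : NonNeg (z * C - (num 1 - a) * Q)
        corner′ = by (≤⇒NonNeg corner) (solve 5 (λ a P C k p → :num 0 :- (P :+ C :- p :- (a :* P :+ C :* k :- a :* p)) := (k :- :num 1) :* C :- (:num 1 :- a) :* (P :- p)) refl a P C k p)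

        z-from-C : NonNeg (z * C) → NonNeg z
        z-from-C q = cancel-NonNeg C>0 (by q (solve 2 (λ z C → z :* C := C :* z) refl z C))

        -- Write w as z + (1 - a). The first part is at most 2zC, as C ≥ 1/2. If a ≤ 1, then Q ≥ 7/8
        -- and `corner′` bounds 1 - a by 8zC/7, and 2 + 8/7 = 22/7. If a ≥ 1, the second part is
        -- nonpositive.
        w≤22/7zC : NonNeg z × NonNeg (num 22 * (z * C) - num 7 * w)
        w≤22/7zC with ≤-total a (num 1)
        ... | inj₁ a≤1 = z≥0 , by (8zC≥7x ⊕ num≥0 7 ⊗ (z≥0 ⊗ C≥1/2))
            (solve 3 (λ a w C → let z = a :+ w :- :num 1 in :num 8 :* (z :* C) :- :num 7 :* (:num 1 :- a) :+ :num 7 :* (z :* (:num 2 :* C :- :num 1))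
              := :num 22 :* (z :* C) :- :num 7 :* w) refl a w C)
          where
          x≥0 = ≤⇒NonNeg a≤1
          8Q≥7 : NonNeg (num 8 * Q - num 7)
          8Q≥7 with ≤-total (num 7) (num 8 * Q)
          ... | inj₁ q = ≤⇒NonNeg q
          ... | inj₂ q = ⊥-elim (negative-absurd 0 (by (aQ≥29/32 ⊕ num≥0 4 ⊗ (ha ⊗ ≤⇒NonNeg q) ⊕ num≥0 28 ⊗ x≥0)
            (solve 2 (λ a Q → :num 32 :* (a :* Q) :- :num 29 :+ :num 4 :* (a :* (:num 7 :- :num 8 :* Q)) :+ :num 28 :* (:num 1 :- a) := con -[1+ 0 ]) refl a Q)))
          8zC≥7x : NonNeg (num 8 * (z * C) - num 7 * (num 1 - a))
          8zC≥7x = by (num≥0 8 ⊗ corner′ ⊕ x≥0 ⊗ 8Q≥7)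
            (solve 3 (λ y x Q → :num 8 :* (y :- x :* Q) :+ x :* (:num 8 :* Q :- :num 7) := :num 8 :* y :- :num 7 :* x) refl (z * C) (num 1 - a) Q)
          z≥0 : NonNeg z
          z≥0 = z-from-C (cancel-NonNeg (Pos-num 7) (by (8zC≥7x ⊕ num≥0 7 ⊗ x≥0)
            (solve 2 (λ y x → :num 8 :* y :- :num 7 :* x :+ :num 7 :* x := :num 8 :* y) refl (z * C) (num 1 - a))))
        ... | inj₂ 1≤a = z≥0 , by (num≥0 8 ⊗ (z≥0 ⊗ C≥0) ⊕ num≥0 7 ⊗ (z≥0 ⊗ C≥1/2) ⊕ num≥0 7 ⊗ x≤0)
            (solve 3 (λ a w C → let z = a :+ w :- :num 1 in :num 8 :* (z :* C) :+ :num 7 :* (z :* (:num 2 :* C :- :num 1)) :+ :num 7 :* (a :- :num 1)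
              := :num 22 :* (z :* C) :- :num 7 :* w) refl a w C)
          where
          x≤0 = ≤⇒NonNeg 1≤a
          z≥0 : NonNeg z
          z≥0 = by (x≤0 ⊕ w≥0) (solve 2 (λ a w → a :- :num 1 :+ w := a :+ w :- :num 1) refl a w)

        zC≥0 : NonNeg (z * C)
        zC≥0 = proj₁ w≤22/7zC ⊗ C≥0

        2zC+3p≤0 : NonNeg (0# - (num 2 * (z * C) + num 3 * p))
        2zC+3p≤0 = by (moves′ ⊕ proj₂ w≤22/7zC)
          (solve 3 (λ w y p → :num 7 :* w :- :num 24 :* y :- :num 3 :* p :+ (:num 22 :* y :- :num 7 :* w) := :num 0 :- (:num 2 :* y :+ :num 3 :* p)) refl w (z * C) p)

        p≤0 : p ≤ 0#
        p≤0 = NonNeg⇒≤ (cancel-NonNeg (Pos-num 2) (by (2zC+3p≤0 ⊕ num≥0 2 ⊗ zC≥0)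
          (solve 2 (λ y p → :num 0 :- (:num 2 :* y :+ :num 3 :* p) :+ :num 2 :* y := :num 3 :* (:num 0 :- p)) refl (z * C) p)))

        w≤0 : w ≤ 0#
        w≤0 = NonNeg⇒≤ (cancel-NonNeg (Pos-num 6) (by (num≥0 11 ⊗ 2zC+3p≤0 ⊕ num≥0 33 ⊗ p≥0 ⊕ proj₂ w≤22/7zC)
          (solve 3 (λ w y p → :num 11 :* (:num 0 :- (:num 2 :* y :+ :num 3 :* p)) :+ :num 33 :* p :+ (:num 22 :* y :- :num 7 :* w) := :num 7 :* (:num 0 :- w)) refl w (z * C) p)))

  -- Invariance of φ under line permutations and transposition

  Σᶠ-cong : ∀ n {f g : Fin n → ℝ} → (∀ i → f i ≡ g i) → Σᶠ n f ≡ Σᶠ n g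
  Σᶠ-cong zero    e = refl
  Σᶠ-cong (suc n) e = cong₂ _+_ (e zero) (Σᶠ-cong n (e ∘ suc))

  Πᶠ-cong : ∀ n {f g : Fin n → ℝ} → (∀ i → f i ≡ g i) → Πᶠ n f ≡ Πᶠ n g
  Πᶠ-cong zero    e = refl
  Πᶠ-cong (suc n) e = cong₂ _*_ (e zero) (Πᶠ-cong n (e ∘ suc))

  φ-cong : ∀ {n} {A B : Matrix n} → (∀ i j → A i j ≡ B i j) → φ A ≡ φ B
  φ-cong {n} {A} {B} e = cong₂ (λ x y → x + - y)
    (cong₂ _+_ (Πᶠ-cong n λ i → Σᶠ-cong n (e i)) (Πᶠ-cong n λ j → Σᶠ-cong n λ i → e i j))
    (cong sumL (map-cong (λ σ → cong prodL (zipWith-cong e (allFin n) σ)) (permutations (allFin n))))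

  totalSum-cong : ∀ {n} {A B : Matrix n} → (∀ i j → A i j ≡ B i j) → totalSum A ≡ totalSum B
  totalSum-cong {n} e = Σᶠ-cong n λ i → Σᶠ-cong n (e i)

  Σᶠ-swap : ∀ n (k : Fin n) f → Σᶠ (suc n) (f ∘ swapAt k) ≡ Σᶠ (suc n) f
  Σᶠ-swap (suc n) zero    f = solve 3 (λ x y z → y :+ (x :+ z) := x :+ (y :+ z)) refl (f zero) (f (suc zero)) (Σᶠ n (λ i → f (suc (suc i))))
  Σᶠ-swap (suc n) (suc k) f = cong (f zero +_) (Σᶠ-swap n k (f ∘ suc))

  Πᶠ-swap : ∀ n (k : Fin n) f → Πᶠ (suc n) (f ∘ swapAt k) ≡ Πᶠ (suc n) f
  Πᶠ-swap (suc n) zero    f = solve 3 (λ x y z → y :* (x :* z) := x :* (y :* z)) refl (f zero) (f (suc zero)) (Πᶠ n (λ i → f (suc (suc i))))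
  Πᶠ-swap (suc n) (suc k) f = cong (f zero *_) (Πᶠ-swap n k (f ∘ suc))

  -- Follows the list definition of `per` literally, so that its value at `entries A` unfolds to
  -- `per A` and the solver can check identities between permanents.
  :per : ∀ {k} → (Fin 4 → Fin 4 → Polynomial k) → Polynomial k
  :per X = foldr _:+_ (:num 0) (map (λ σ → foldr _:*_ (:num 1) (zipWith X (allFin 4) σ)) (permutations (allFin 4)))

  entries : Matrix 4 → Vec ℝ 16
  entries A = concat (tabulate λ i → tabulate (A i))

  :entry : Fin 4 → Fin 4 → Polynomial 16
  :entry i j = var (combine i j)

  per-swap : ∀ k (A : Matrix 4) → per (A ∘ swapAt k) ≡ per A
  per-swap 0F A = prove (entries A) (:per (:entry ∘ swapAt 0F)) (:per :entry) refl
  per-swap 1F A = prove (entries A) (:per (:entry ∘ swapAt 1F)) (:per :entry) refl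
  per-swap 2F A = prove (entries A) (:per (:entry ∘ swapAt 2F)) (:per :entry) refl

  transpose : ∀ {n} → Matrix n → Matrix n
  transpose A i j = A j i

  per-transpose : (A : Matrix 4) → per (transpose A) ≡ per A
  per-transpose A = prove (entries A) (:per λ i j → :entry j i) (:per :entry) refl

  φ-swap : ∀ k (A : Matrix 4) → φ (A ∘ swapAt k) ≡ φ A
  φ-swap k A = cong₂ (λ x y → x + - y)
    (cong₂ _+_ (Πᶠ-swap 3 k (rowSum A)) (Πᶠ-cong 4 λ j → Σᶠ-swap 3 k λ i → A i j)) (per-swap k A)

  φ-transpose : (A : Matrix 4) → φ (transpose A) ≡ φ A
  φ-transpose A = cong₂ (λ x y → x + - y)
    (solve 2 (λ x y → x :+ y := y :+ x) refl (Πᶠ 4 (colSum A)) (Πᶠ 4 (rowSum A))) (per-transpose A)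

  totalSum-transpose : (A : Matrix 4) → totalSum (transpose A) ≡ totalSum A
  totalSum-transpose A = prove (entries A) (:total λ i j → :entry j i) (:total :entry) refl
    where
    :Σ : (Fin 4 → Polynomial 16) → Polynomial 16
    :Σ f = f 0F :+ (f 1F :+ (f 2F :+ (f 3F :+ :num 0)))
    :total : (Fin 4 → Fin 4 → Polynomial 16) → Polynomial 16
    :total X = :Σ λ i → :Σ (X i)

  maximizing-swap : ∀ k {A} → PhiMaximizing 4 A → PhiMaximizing 4 (A ∘ swapAt k)
  maximizing-swap k {A} ((A≥0 , total) , max) =
    ((λ i j → A≥0 (swapAt k i) j) , trans (Σᶠ-swap 3 k (rowSum A)) total) ,
    λ X X∈K → subst (φ X ≤_) (sym (φ-swap k A)) (max X X∈K)

  maximizing-transpose : ∀ {A} → PhiMaximizing 4 A → PhiMaximizing 4 (transpose A)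
  maximizing-transpose {A} ((A≥0 , total) , max) =
    ((λ i j → A≥0 j i) , trans (totalSum-transpose A) total) ,
    λ X X∈K → subst (φ X ≤_) (sym (φ-transpose A)) (max X X∈K)

  NoZeroBlock : Subset 4 → Subset 4 → Set
  NoZeroBlock S T = ∀ A → PhiMaximizing 4 A → (∀ i j → i ∈ S → j ∈ T → A i j ≡ 0#) → ⊥

  noZeroBlock-transpose : ∀ {S T} → NoZeroBlock T S → NoZeroBlock S T
  noZeroBlock-transpose no A max zeros = no (transpose A) (maximizing-transpose max) (λ i j i∈T j∈S → zeros j i j∈S i∈T)

  noZeroBlock-rows : ∀ {S S′ T} → S ↝ S′ → NoZeroBlock S′ T → NoZeroBlock S T
  noZeroBlock-rows done no = no
  noZeroBlock-rows {S} (step k S↝S′) no A max zeros =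
    noZeroBlock-rows S↝S′ no (A ∘ swapAt k) (maximizing-swap k max) (λ i j i∈S j∈T → zeros (swapAt k i) j (∈-swapSet k S i∈S) j∈T)

  noZeroBlock-sort : ∀ {S T} → NoZeroBlock (initial ∣ S ∣) (initial ∣ T ∣) → NoZeroBlock S T
  noZeroBlock-sort {S} {T} no = noZeroBlock-rows (sort S)
    (noZeroBlock-transpose {initial ∣ S ∣} {T} (noZeroBlock-rows (sort T) (noZeroBlock-transpose {initial ∣ T ∣} {initial ∣ S ∣} no)))

  -- The constant matrix and the lower bound for the maximum

  quarter : ℝ
  quarter = proj₁ (inverse (num 4) (λ e → Pos-num 3 (subst (_≤ 0#) (sym e) (≤-refl 0#))))

  4*quarter : num 4 * quarter ≡ 1#
  4*quarter = proj₂ (inverse (num 4) (λ e → Pos-num 3 (subst (_≤ 0#) (sym e) (≤-refl 0#))))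

  J : Matrix 4
  J _ _ = quarter

  J∈K : InK 4 J
  J∈K = (λ _ _ → cancel-NonNeg (Pos-num 3) (by (num≥0 1) (sym 4*quarter))) , (begin
    totalSum J                 ≡⟨ solve 1 (λ q → let r = q :+ (q :+ (q :+ (q :+ :num 0))) in r :+ (r :+ (r :+ (r :+ :num 0))) := :num 4 :* (:num 4 :* q)) refl quarter ⟩
    num 4 * (num 4 * quarter)  ≡⟨ cong (num 4 *_) 4*quarter ⟩
    num 4 * 1#                 ≡⟨ solve 0 (:num 4 :* :num 1 := :num 1 :+ (:num 1 :+ (:num 1 :+ (:num 1 :+ :num 0)))) refl ⟩
    ℕ→ℝ 4                      ∎)
    where open ≡-Reasoning

  -- For constant entries q each line product is 256q⁴ and the permanent 24q⁴, and 32 · 488 = 61 ·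
  -- 256.
  32φJ : num 32 * φ J ≡ num 61
  32φJ = begin
    num 32 * φ J                      ≡⟨ prove (quarter ∷ []) (:num 32 :* (:Π (λ _ → :row) :+ :Π (λ _ → :row) :+ :- :per (λ _ _ → q)))
                                            (:num 61 :* ((:num 4 :* q) :² :²)) refl ⟩
    num 61 * ((num 4 * quarter) ² ²)  ≡⟨ cong (λ z → num 61 * (z ² ²)) 4*quarter ⟩
    num 61 * (1# ² ²)                 ≡⟨ solve 0 (:num 61 :* :num 1 :² :² := :num 61) refl ⟩
    num 61                            ∎
    where
    open ≡-Reasoning
    q : Polynomial 1
    q = var 0F
    :row = q :+ (q :+ (q :+ (q :+ :num 0)))
    :Π : (Fin 4 → Polynomial 1) → Polynomial 1
    :Π f = f 0F :* (f 1F :* (f 2F :* (f 3F :* :num 1)))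

  φ-max≥61/32 : ∀ {A} → PhiMaximizing 4 A → NonNeg (num 32 * φ A - num 61)
  φ-max≥61/32 {A} (_ , max) = by (num≥0 32 ⊗ ≤⇒NonNeg (max J J∈K))
    (trans (solve 2 (λ x y → :num 32 :* (x :- y) := :num 32 :* x :- :num 32 :* y) refl (φ A) (φ J)) (cong (λ z → num 32 * φ A - z) 32φJ))

  Π₄ : ∀ (f : Fin 4 → ℝ) {a b c d} → f 0F ≡ a → f 1F ≡ b → f 2F ≡ c → f 3F ≡ d → Πᶠ 4 f ≡ a * b * (c * d)
  Π₄ f refl refl refl refl = solve 4 (λ a b c d → a :* (b :* (c :* (d :* :num 1))) := a :* b :* (c :* d)) refl (f 0F) (f 1F) (f 2F) (f 3F)

  Σ₄ : ∀ (f : Fin 4 → ℝ) {a b c d} → f 0F ≡ a → f 1F ≡ b → f 2F ≡ c → f 3F ≡ d → Σᶠ 4 f ≡ a + b + (c + d)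
  Σ₄ f refl refl refl refl = solve 4 (λ a b c d → a :+ (b :+ (c :+ (d :+ :num 0))) := a :+ b :+ (c :+ d)) refl (f 0F) (f 1F) (f 2F) (f 3F)

  ℕ→ℝ-4 : ℕ→ℝ 4 ≡ num 4
  ℕ→ℝ-4 = solve 0 (:num 1 :+ (:num 1 :+ (:num 1 :+ (:num 1 :+ :num 0))) := :num 4) refl

  -- Excluding a 2 × 2 zero block

  module ZeroCorner (A : Matrix 4) where

    cut : Matrix 4
    cut 0F 0F = 0#
    cut 0F 1F = 0#
    cut 1F 0F = 0#
    cut 1F 1F = 0#
    cut i  j  = A i j

    :cut : Fin 4 → Fin 4 → Polynomial 16
    :cut 0F 0F = :num 0
    :cut 0F 1F = :num 0
    :cut 1F 0F = :num 0
    :cut 1F 1F = :num 0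
    :cut i  j  = :entry i j

    open TwoByTwo (A 0F 2F) (A 0F 3F) (A 1F 2F) (A 1F 3F) (A 2F 0F) (A 2F 1F) (A 3F 0F) (A 3F 1F) (A 2F 2F) (A 2F 3F) (A 3F 2F) (A 3F 3F) public

    per-cut : per cut ≡ β * δ
    per-cut = prove (entries A) (:per :cut)
      (:per₂ (:entry 0F 2F) (:entry 0F 3F) (:entry 1F 2F) (:entry 1F 3F) :* :per₂ (:entry 2F 0F) (:entry 3F 0F) (:entry 2F 1F) (:entry 3F 1F)) refl

    0+0+ : ∀ x y → 0# + (0# + (x + (y + 0#))) ≡ x + y
    0+0+ = solve 2 (λ x y → :num 0 :+ (:num 0 :+ (x :+ (y :+ :num 0))) := x :+ y) refl

    nested : ∀ x y z t → x + (y + (z + (t + 0#))) ≡ x + y + (z + t)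
    nested = solve 4 (λ x y z t → x :+ (y :+ (z :+ (t :+ :num 0))) := x :+ y :+ (z :+ t)) refl

    φ-cut : φ cut ≡ r₁ * r₂ * (r₃ * r₄) + c₁ * c₂ * (c₃ * c₄) - β * δ
    φ-cut = cong₂ _-_ (cong₂ _+_
        (Π₄ (rowSum cut) (0+0+ _ _) (0+0+ _ _) (nested _ _ _ _) (nested _ _ _ _))
        (Π₄ (colSum cut) (0+0+ _ _) (0+0+ _ _) (nested _ _ _ _) (nested _ _ _ _))) per-cut

    totalSum-cut : totalSum cut ≡ r₁ + r₂ + (r₃ + r₄)
    totalSum-cut = Σ₄ (rowSum cut) (0+0+ _ _) (0+0+ _ _) (nested _ _ _ _) (nested _ _ _ _)

  noZeroBlock₂₂ : NoZeroBlock (initial 2) (initial 2)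
  noZeroBlock₂₂ A max@((A≥0 , total) , _) zeros =
    impossible (A≥0 _ _) (A≥0 _ _) (A≥0 _ _) (A≥0 _ _) (A≥0 _ _) (A≥0 _ _) (A≥0 _ _) (A≥0 _ _) (A≥0 _ _) (A≥0 _ _) (A≥0 _ _) (A≥0 _ _)
      (trans (sym totalSum-cut) (trans (sym (totalSum-cong A≡cut)) (trans total ℕ→ℝ-4)))
      (by (φ-max≥61/32 max) (cong (λ x → num 32 * x - num 61) (trans (φ-cong A≡cut) φ-cut)))
    where
    open ZeroCorner A
    A≡cut : ∀ i j → A i j ≡ cut i j
    A≡cut 0F 0F = zeros _ _ here here
    A≡cut 0F 1F = zeros _ _ here (there here)
    A≡cut 0F 2F = refl
    A≡cut 0F 3F = refl
    A≡cut 1F 0F = zeros _ _ (there here) here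
    A≡cut 1F 1F = zeros _ _ (there here) (there here)
    A≡cut 1F 2F = refl
    A≡cut 1F 3F = refl
    A≡cut 2F j  = refl
    A≡cut 3F j  = refl

  -- The cardinality hypotheses say that the two rows and the two columns are distinct; for concrete
  -- indices they hold by `refl`.
  noZeroBlock-pairs : ∀ {i i′ j j′} → ∣ ⁅ i ⁆ ∪ ⁅ i′ ⁆ ∣ ≡ 2 → ∣ ⁅ j ⁆ ∪ ⁅ j′ ⁆ ∣ ≡ 2 → ∀ {A} → PhiMaximizing 4 A →
    A i j ≡ 0# → A i j′ ≡ 0# → A i′ j ≡ 0# → A i′ j′ ≡ 0# → ⊥
  noZeroBlock-pairs {i} {i′} {j} {j′} 2-rows 2-cols {A} max z₁ z₂ z₃ z₄ =
    noZeroBlock-sort {⁅ i ⁆ ∪ ⁅ i′ ⁆} {⁅ j ⁆ ∪ ⁅ j′ ⁆}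
      (cong₂-NoZeroBlock (sym 2-rows) (sym 2-cols) noZeroBlock₂₂) A max zeros
    where
    cong₂-NoZeroBlock : ∀ {m n m′ n′} → m ≡ m′ → n ≡ n′ → NoZeroBlock (initial m) (initial n) → NoZeroBlock (initial m′) (initial n′)
    cong₂-NoZeroBlock refl refl no = no
    zeros : ∀ k l → k ∈ ⁅ i ⁆ ∪ ⁅ i′ ⁆ → l ∈ ⁅ j ⁆ ∪ ⁅ j′ ⁆ → A k l ≡ 0#
    zeros k l k∈ l∈ with x∈p∪q⁻ ⁅ i ⁆ ⁅ i′ ⁆ k∈ | x∈p∪q⁻ ⁅ j ⁆ ⁅ j′ ⁆ l∈
    ... | inj₁ p | inj₁ q rewrite x∈⁅y⁆⇒x≡y i p | x∈⁅y⁆⇒x≡y j q = z₁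
    ... | inj₁ p | inj₂ q rewrite x∈⁅y⁆⇒x≡y i p | x∈⁅y⁆⇒x≡y j′ q = z₂
    ... | inj₂ p | inj₁ q rewrite x∈⁅y⁆⇒x≡y i′ p | x∈⁅y⁆⇒x≡y j q = z₃
    ... | inj₂ p | inj₂ q rewrite x∈⁅y⁆⇒x≡y i′ p | x∈⁅y⁆⇒x≡y j′ q = z₄

  -- Which factor of a vanishing product is zero cannot be decided. With `⊥` as the goal one may
  -- first refute `y ≡ 0#`, which yields `x ≡ 0#` up to double negation, or the reverse; the uses
  -- below are nested accordingly.
  zero-product : ∀ {x y} → NonNeg x → NonNeg y → x * y ≤ 0# → ¬ (x ≡ 0#) → y ≡ 0#
  zero-product {x} {y} hx hy xy≤0 x≢0 = ≤-antisym (NonNeg⇒≤ (cancel-NonNeg (λ x≤0 → x≢0 (≤-antisym x≤0 hx)) (by (≤⇒NonNeg xy≤0)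
    (solve 2 (λ x y → :num 0 :- x :* y := x :* (:num 0 :- y)) refl x y)))) hy

  ≤0-left : ∀ {x y} → NonNeg y → x + y ≤ 0# → x ≤ 0#
  ≤0-left {x} {y} hy q = NonNeg⇒≤ (by (≤⇒NonNeg q ⊕ hy) (solve 2 (λ x y → :num 0 :- (x :+ y) :+ y := :num 0 :- x) refl x y))

  ≤0-right : ∀ {x y} → NonNeg x → x + y ≤ 0# → y ≤ 0#
  ≤0-right {x} {y} hx q = NonNeg⇒≤ (by (≤⇒NonNeg q ⊕ hx) (solve 2 (λ x y → :num 0 :- (x :+ y) :+ x := :num 0 :- y) refl x y))

  -- Excluding a 1 × 3 zero block

  module ZeroRow (A : Matrix 4) where

    withRow : Vec ℝ 4 → Matrix 4
    withRow y zero    = lookup y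
    withRow y (suc i) = A (suc i)

    open RowCase (A 0F 3F) (A 1F 0F) (A 1F 1F) (A 1F 2F) (A 2F 0F) (A 2F 1F) (A 2F 2F) (A 3F 0F) (A 3F 1F) (A 3F 2F) (A 1F 3F) (A 2F 3F) (A 3F 3F) public

    a = A 0F 3F

    row-sum : ∀ x y z t → x + (y + (z + (t + 0#))) ≡ x + y + z + t
    row-sum = solve 4 (λ x y z t → x :+ (y :+ (z :+ (t :+ :num 0))) := x :+ y :+ z :+ t) refl

    col-sum : ∀ x y z t → x + (y + (z + (t + 0#))) ≡ x + (y + z + t)
    col-sum = solve 4 (λ x y z t → x :+ (y :+ (z :+ (t :+ :num 0))) := x :+ (y :+ z :+ t)) refl

    module _ (y₀ y₁ y₂ y₃ : ℝ) where

      X = withRow (y₀ ∷ y₁ ∷ y₂ ∷ y₃ ∷ [])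

      per-withRow : per X ≡ y₀ * q₁ + y₁ * q₂ + y₂ * q₃ + y₃ * p
      per-withRow = prove (entries X) (:per :entry)
        (v 0F 0F :* :per₃ (v 1F 1F) (v 1F 2F) (v 1F 3F) (v 2F 1F) (v 2F 2F) (v 2F 3F) (v 3F 1F) (v 3F 2F) (v 3F 3F)
         :+ v 0F 1F :* :per₃ (v 1F 0F) (v 1F 2F) (v 1F 3F) (v 2F 0F) (v 2F 2F) (v 2F 3F) (v 3F 0F) (v 3F 2F) (v 3F 3F)
         :+ v 0F 2F :* :per₃ (v 1F 0F) (v 1F 1F) (v 1F 3F) (v 2F 0F) (v 2F 1F) (v 2F 3F) (v 3F 0F) (v 3F 1F) (v 3F 3F)
         :+ v 0F 3F :* :per₃ (v 1F 0F) (v 1F 1F) (v 1F 2F) (v 2F 0F) (v 2F 1F) (v 2F 2F) (v 3F 0F) (v 3F 1F) (v 3F 2F)) refl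
        where v = :entry

      φ-withRow : φ X ≡ (y₀ + y₁ + y₂ + y₃) * r₁ * (r₂ * r₃) + (y₀ + g₁) * (y₁ + g₂) * ((y₂ + g₃) * (y₃ + w)) - (y₀ * q₁ + y₁ * q₂ + y₂ * q₃ + y₃ * p)
      φ-withRow = cong₂ _-_ (cong₂ _+_
        (Π₄ (rowSum X) (row-sum _ _ _ _) (row-sum _ _ _ _) (row-sum _ _ _ _) (row-sum _ _ _ _))
        (Π₄ (colSum X) (col-sum _ _ _ _) (col-sum _ _ _ _) (col-sum _ _ _ _) (col-sum _ _ _ _))) per-withRow

      totalSum-withRow : totalSum X ≡ y₀ + y₁ + y₂ + y₃ + r₁ + (r₂ + r₃)
      totalSum-withRow = Σ₄ (rowSum X) (row-sum _ _ _ _) (row-sum _ _ _ _) (row-sum _ _ _ _) (row-sum _ _ _ _)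

  module MaximizingZeroRow (A : Matrix 4) (A-max : PhiMaximizing 4 A)
    (A₀₀ : A 0F 0F ≡ 0#) (A₀₁ : A 0F 1F ≡ 0#) (A₀₂ : A 0F 2F ≡ 0#) where

    open ZeroRow A

    A≥0 = proj₁ (proj₁ A-max)

    A≡withRow : ∀ i j → A i j ≡ withRow (0# ∷ 0# ∷ 0# ∷ a ∷ []) i j
    A≡withRow 0F      0F = A₀₀
    A≡withRow 0F      1F = A₀₁
    A≡withRow 0F      2F = A₀₂
    A≡withRow 0F      3F = refl
    A≡withRow (suc i) j  = refl

    φA : φ A ≡ a * P + C * k - a * p
    φA = trans (φ-cong A≡withRow) (trans (φ-withRow 0# 0# 0# a)
      (solve 12 (λ a r₁ r₂ r₃ g₁ g₂ g₃ w q₁ q₂ q₃ p →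
          (:num 0 :+ :num 0 :+ :num 0 :+ a) :* r₁ :* (r₂ :* r₃) :+ (:num 0 :+ g₁) :* (:num 0 :+ g₂) :* ((:num 0 :+ g₃) :* (a :+ w))
            :- (:num 0 :* q₁ :+ :num 0 :* q₂ :+ :num 0 :* q₃ :+ a :* p)
          := a :* (r₁ :* r₂ :* r₃) :+ g₁ :* g₂ :* g₃ :* (a :+ w) :- a :* p)
        refl a r₁ r₂ r₃ g₁ g₂ g₃ w q₁ q₂ q₃ p))

    total : a + r₁ + (r₂ + r₃) ≡ num 4
    total = begin
      a + r₁ + (r₂ + r₃)                                   ≡⟨ solve 4 (λ a x y z → a :+ x :+ (y :+ z) := :num 0 :+ :num 0 :+ :num 0 :+ a :+ x :+ (y :+ z)) refl a r₁ r₂ r₃ ⟩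
      0# + 0# + 0# + a + r₁ + (r₂ + r₃)                    ≡⟨ totalSum-withRow 0# 0# 0# a ⟨
      totalSum (withRow (0# ∷ 0# ∷ 0# ∷ a ∷ []))           ≡⟨ totalSum-cong A≡withRow ⟨
      totalSum A                                           ≡⟨ proj₂ (proj₁ A-max) ⟩
      ℕ→ℝ 4                                                ≡⟨ ℕ→ℝ-4 ⟩
      num 4                                                ∎
      where open ≡-Reasoning

    withRow≥0 : ∀ {B : Matrix 4} → (∀ i j → NonNeg (B i j)) → ∀ {y₀ y₁ y₂ y₃} → NonNeg y₀ → NonNeg y₁ → NonNeg y₂ → NonNeg y₃ →
      ∀ i j → NonNeg (ZeroRow.withRow B (y₀ ∷ y₁ ∷ y₂ ∷ y₃ ∷ []) i j)
    withRow≥0 B≥0 h₀ h₁ h₂ h₃ 0F      0F = h₀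
    withRow≥0 B≥0 h₀ h₁ h₂ h₃ 0F      1F = h₁
    withRow≥0 B≥0 h₀ h₁ h₂ h₃ 0F      2F = h₂
    withRow≥0 B≥0 h₀ h₁ h₂ h₃ 0F      3F = h₃
    withRow≥0 B≥0 h₀ h₁ h₂ h₃ (suc i) j  = B≥0 (suc i) j

    new-row : ∀ {y₀ y₁ y₂ y₃} → NonNeg y₀ → NonNeg y₁ → NonNeg y₂ → NonNeg y₃ → y₀ + y₁ + y₂ + y₃ ≡ a →
      NonNeg (a * P + C * k - a * p -
        ((y₀ + y₁ + y₂ + y₃) * r₁ * (r₂ * r₃) + (y₀ + g₁) * (y₁ + g₂) * ((y₂ + g₃) * (y₃ + w)) - (y₀ * q₁ + y₁ * q₂ + y₂ * q₃ + y₃ * p)))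
    new-row {y₀} {y₁} {y₂} {y₃} h₀ h₁ h₂ h₃ sum = by (≤⇒NonNeg (proj₂ A-max (X y₀ y₁ y₂ y₃)
        (withRow≥0 A≥0 h₀ h₁ h₂ h₃ , trans (totalSum-withRow y₀ y₁ y₂ y₃) (trans (cong (λ s → s + r₁ + (r₂ + r₃)) sum) (trans total (sym ℕ→ℝ-4))))))
      (cong₂ _-_ φA (φ-withRow y₀ y₁ y₂ y₃))

    h : NonNeg (num 32 * (a * P + C * k - a * p) - num 61)
    h = by (φ-max≥61/32 A-max) (cong (λ x → num 32 * x - num 61) φA)

    a≥0 = A≥0 0F 3F

    open Bounds a≥0 (A≥0 _ _) (A≥0 _ _) (A≥0 _ _) (A≥0 _ _) (A≥0 _ _) (A≥0 _ _) (A≥0 _ _) (A≥0 _ _) (A≥0 _ _)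
      (A≥0 _ _) (A≥0 _ _) (A≥0 _ _) total h

    col≥0 : ∀ j → NonNeg (A 1F j + A 2F j + A 3F j)
    col≥0 j = A≥0 1F j ⊕ A≥0 2F j ⊕ A≥0 3F j

    -- Shifting `τ * a` from the corner to column 0 keeps all row sums, and the permanent is linear
    -- in the top row. The only second-order term therefore comes from the two changed column sums,
    -- which gives the constant `a * a * (g₂ * g₃)`.
    move₁ : ¬ Pos (k * (g₂ * g₃) - C - q₁ + p)
    move₁ θ>0 = linear-term-nonpos (a * (k * (g₂ * g₃) - C - q₁ + p)) (a * a * (g₂ * g₃)) (a≥0 ⊗ a≥0 ⊗ (col≥0 1F ⊗ col≥0 2F))
      (λ τ τ≥0 τ≤1 → by (new-row {τ * a} {0#} {0#} {(num 1 - τ) * a} (τ≥0 ⊗ a≥0) (num≥0 0) (num≥0 0) (τ≤1 ⊗ a≥0)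
          (solve 2 (λ τ a → τ :* a :+ :num 0 :+ :num 0 :+ (:num 1 :- τ) :* a := a) refl τ a))
        (solve 13 (λ τ a r₁ r₂ r₃ g₁ g₂ g₃ w q₁ q₂ q₃ p → let C = g₁ :* g₂ :* g₃ ; k = a :+ w in
            a :* (r₁ :* r₂ :* r₃) :+ C :* k :- a :* p :-
              ((τ :* a :+ :num 0 :+ :num 0 :+ (:num 1 :- τ) :* a) :* r₁ :* (r₂ :* r₃) :+ (τ :* a :+ g₁) :* (:num 0 :+ g₂) :* ((:num 0 :+ g₃) :* ((:num 1 :- τ) :* a :+ w))
                :- (τ :* a :* q₁ :+ :num 0 :* q₂ :+ :num 0 :* q₃ :+ (:num 1 :- τ) :* a :* p))
            := a :* a :* (g₂ :* g₃) :* τ :² :- τ :* (a :* (k :* (g₂ :* g₃) :- C :- q₁ :+ p)))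
          refl τ a r₁ r₂ r₃ g₁ g₂ g₃ w q₁ q₂ q₃ p))
      (Pos-* a>0 θ>0)

    move₂ : ¬ Pos (k * (g₁ * g₃) - C - q₂ + p)
    move₂ θ>0 = linear-term-nonpos (a * (k * (g₁ * g₃) - C - q₂ + p)) (a * a * (g₁ * g₃)) (a≥0 ⊗ a≥0 ⊗ (col≥0 0F ⊗ col≥0 2F))
      (λ τ τ≥0 τ≤1 → by (new-row {0#} {τ * a} {0#} {(num 1 - τ) * a} (num≥0 0) (τ≥0 ⊗ a≥0) (num≥0 0) (τ≤1 ⊗ a≥0)
          (solve 2 (λ τ a → :num 0 :+ τ :* a :+ :num 0 :+ (:num 1 :- τ) :* a := a) refl τ a))
        (solve 13 (λ τ a r₁ r₂ r₃ g₁ g₂ g₃ w q₁ q₂ q₃ p → let C = g₁ :* g₂ :* g₃ ; k = a :+ w in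
            a :* (r₁ :* r₂ :* r₃) :+ C :* k :- a :* p :-
              ((:num 0 :+ τ :* a :+ :num 0 :+ (:num 1 :- τ) :* a) :* r₁ :* (r₂ :* r₃) :+ (:num 0 :+ g₁) :* (τ :* a :+ g₂) :* ((:num 0 :+ g₃) :* ((:num 1 :- τ) :* a :+ w))
                :- (:num 0 :* q₁ :+ τ :* a :* q₂ :+ :num 0 :* q₃ :+ (:num 1 :- τ) :* a :* p))
            := a :* a :* (g₁ :* g₃) :* τ :² :- τ :* (a :* (k :* (g₁ :* g₃) :- C :- q₂ :+ p)))
          refl τ a r₁ r₂ r₃ g₁ g₂ g₃ w q₁ q₂ q₃ p))
      (Pos-* a>0 θ>0)

    move₃ : ¬ Pos (k * (g₁ * g₂) - C - q₃ + p)
    move₃ θ>0 = linear-term-nonpos (a * (k * (g₁ * g₂) - C - q₃ + p)) (a * a * (g₁ * g₂)) (a≥0 ⊗ a≥0 ⊗ (col≥0 0F ⊗ col≥0 1F))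
      (λ τ τ≥0 τ≤1 → by (new-row {0#} {0#} {τ * a} {(num 1 - τ) * a} (num≥0 0) (num≥0 0) (τ≥0 ⊗ a≥0) (τ≤1 ⊗ a≥0)
          (solve 2 (λ τ a → :num 0 :+ :num 0 :+ τ :* a :+ (:num 1 :- τ) :* a := a) refl τ a))
        (solve 13 (λ τ a r₁ r₂ r₃ g₁ g₂ g₃ w q₁ q₂ q₃ p → let C = g₁ :* g₂ :* g₃ ; k = a :+ w in
            a :* (r₁ :* r₂ :* r₃) :+ C :* k :- a :* p :-
              ((:num 0 :+ :num 0 :+ τ :* a :+ (:num 1 :- τ) :* a) :* r₁ :* (r₂ :* r₃) :+ (:num 0 :+ g₁) :* (:num 0 :+ g₂) :* ((τ :* a :+ g₃) :* ((:num 1 :- τ) :* a :+ w))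
                :- (:num 0 :* q₁ :+ :num 0 :* q₂ :+ τ :* a :* q₃ :+ (:num 1 :- τ) :* a :* p))
            := a :* a :* (g₁ :* g₂) :* τ :² :- τ :* (a :* (k :* (g₁ :* g₂) :- C :- q₃ :+ p)))
          refl τ a r₁ r₂ r₃ g₁ g₂ g₃ w q₁ q₂ q₃ p))
      (Pos-* a>0 θ>0)

    -- The segment from A to the matrix whose only nonzero entry is a 4 in the corner (0, 3).
    module Corner (τ : ℝ) (τ≥0 : NonNeg τ) (τ≤1 : NonNeg (num 1 - τ)) where

      s = num 1 - τ
      y = s * a + num 4 * τ

      scaled : Matrix 4
      scaled i j = s * A i j

      module S = ZeroRow scaled

      scaled-row : ∀ x y z t → s * x + s * y + s * z + s * t ≡ s * (x + y + z + t)
      scaled-row = solve 5 (λ s x y z t → s :* x :+ s :* y :+ s :* z :+ s :* t := s :* (x :+ y :+ z :+ t)) refl s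

      scaled-col : ∀ x y z → s * x + s * y + s * z ≡ s * (x + y + z)
      scaled-col = solve 4 (λ s x y z → s :* x :+ s :* y :+ s :* z := s :* (x :+ y :+ z)) refl s

      scaled-per : S.p ≡ s * (s * s) * p
      scaled-per = solve 10 (λ s a b c d e f g h i → :per₃ (s :* a) (s :* b) (s :* c) (s :* d) (s :* e) (s :* f) (s :* g) (s :* h) (s :* i)
        := s :* (s :* s) :* :per₃ a b c d e f g h i) refl s (A 1F 0F) (A 1F 1F) (A 1F 2F) (A 2F 0F) (A 2F 1F) (A 2F 2F) (A 3F 0F) (A 3F 1F) (A 3F 2F)

      φ-corner : φ (S.X 0# 0# 0# y) ≡ y * (s * r₁) * (s * r₂ * (s * r₃)) + s * g₁ * (s * g₂) * (s * g₃ * (y + s * w)) - y * (s * (s * s) * p)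
      φ-corner = trans (S.φ-withRow 0# 0# 0# y) (trans
        (solve 12 (λ a r₁ r₂ r₃ g₁ g₂ g₃ w q₁ q₂ q₃ p →
          (:num 0 :+ :num 0 :+ :num 0 :+ a) :* r₁ :* (r₂ :* r₃) :+ (:num 0 :+ g₁) :* (:num 0 :+ g₂) :* ((:num 0 :+ g₃) :* (a :+ w))
            :- (:num 0 :* q₁ :+ :num 0 :* q₂ :+ :num 0 :* q₃ :+ a :* p)
          := a :* r₁ :* (r₂ :* r₃) :+ g₁ :* g₂ :* (g₃ :* (a :+ w)) :- a :* p)
          refl y S.r₁ S.r₂ S.r₃ S.g₁ S.g₂ S.g₃ S.w S.q₁ S.q₂ S.q₃ S.p)
        (cong₂ _-_ (cong₂ _+_
          (cong₂ _*_ (cong (y *_) (scaled-row _ _ _ _)) (cong₂ _*_ (scaled-row _ _ _ _) (scaled-row _ _ _ _)))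
          (cong₂ _*_ (cong₂ _*_ (scaled-col _ _ _) (scaled-col _ _ _)) (cong₂ _*_ (scaled-col _ _ _) (cong (y +_) (scaled-col _ _ _)))))
          (cong (y *_) scaled-per)))

      total-corner : totalSum (S.X 0# 0# 0# y) ≡ ℕ→ℝ 4
      total-corner = begin
        totalSum (S.X 0# 0# 0# y)                      ≡⟨ S.totalSum-withRow 0# 0# 0# y ⟩
        0# + 0# + 0# + y + S.r₁ + (S.r₂ + S.r₃)        ≡⟨ cong₂ _+_ (cong (0# + 0# + 0# + y +_) (scaled-row _ _ _ _)) (cong₂ _+_ (scaled-row _ _ _ _) (scaled-row _ _ _ _)) ⟩
        0# + 0# + 0# + y + s * r₁ + (s * r₂ + s * r₃)  ≡⟨ solve 5 (λ τ a r₁ r₂ r₃ → let s = :num 1 :- τ in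
            :num 0 :+ :num 0 :+ :num 0 :+ (s :* a :+ :num 4 :* τ) :+ s :* r₁ :+ (s :* r₂ :+ s :* r₃) := s :* (a :+ r₁ :+ (r₂ :+ r₃)) :+ :num 4 :* τ) refl τ a r₁ r₂ r₃ ⟩
        s * (a + r₁ + (r₂ + r₃)) + num 4 * τ           ≡⟨ cong (λ z → s * z + num 4 * τ) total ⟩
        s * num 4 + num 4 * τ                          ≡⟨ solve 1 (λ τ → (:num 1 :- τ) :* :num 4 :+ :num 4 :* τ := :num 4) refl τ ⟩
        num 4                                          ≡⟨ ℕ→ℝ-4 ⟨
        ℕ→ℝ 4                                          ∎
        where open ≡-Reasoning

      corner-bound : NonNeg (a * P + C * k - a * p - (y * (s * r₁) * (s * r₂ * (s * r₃)) + s * g₁ * (s * g₂) * (s * g₃ * (y + s * w)) - y * (s * (s * s) * p)))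
      corner-bound = by (≤⇒NonNeg (proj₂ A-max (S.X 0# 0# 0# y)
          (withRow≥0 (λ i j → τ≤1 ⊗ A≥0 i j) (num≥0 0) (num≥0 0) (num≥0 0) (τ≤1 ⊗ a≥0 ⊕ num≥0 4 ⊗ τ≥0) , total-corner)))
        (cong₂ _-_ φA φ-corner)

      -- By homogeneity φ on the segment is s⁴φ(A) + 4τs³(P + C - p). In the difference, 1 - s⁴ is
      -- replaced by 4τ, s³ before p by 1, and s³ before P + C by 1 - 3τ; each replacement only
      -- weakens the inequality, and a factor 4 cancels.
      linear-bound : NonNeg (num 3 * (P + C) * τ ² - τ * (P + C - p - (a * P + C * k - a * p)))
      linear-bound = cancel-NonNeg (Pos-num 3) (by (corner-bound
          ⊕ φ≥0 ⊗ sq≥0 τ ⊗ (num≥0 2 ⊕ num≥0 4 ⊗ τ≤1 ⊕ sq≥0 τ)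
          ⊕ num≥0 4 ⊗ (sq≥0 τ ⊗ (num≥0 3 ⊗ τ≤1 ⊕ sq≥0 τ) ⊗ p≥0)
          ⊕ num≥0 4 ⊗ (sq≥0 τ ⊗ (τ≥0 ⊗ (num≥0 2 ⊕ τ≤1)) ⊗ (P≥0 ⊕ C≥0)))
        (solve 10 (λ τ a r₁ r₂ r₃ g₁ g₂ g₃ w p → let s = :num 1 :- τ ; y = s :* a :+ :num 4 :* τ ; P = r₁ :* r₂ :* r₃ ; C = g₁ :* g₂ :* g₃ ; F = a :* P :+ C :* (a :+ w) :- a :* p in
            F :- (y :* (s :* r₁) :* (s :* r₂ :* (s :* r₃)) :+ s :* g₁ :* (s :* g₂) :* (s :* g₃ :* (y :+ s :* w)) :- y :* (s :* (s :* s) :* p))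
            :+ F :* τ :² :* (:num 2 :+ :num 4 :* s :+ τ :²)
            :+ :num 4 :* (τ :² :* (:num 3 :* s :+ τ :²) :* p)
            :+ :num 4 :* (τ :² :* (τ :* (:num 2 :+ s)) :* (P :+ C))
            := :num 4 :* (:num 3 :* (P :+ C) :* τ :² :- τ :* (P :+ C :- p :- F))) refl τ a r₁ r₂ r₃ g₁ g₂ g₃ w p))

    corner : ¬ Pos (P + C - p - (a * P + C * k - a * p))
    corner = linear-term-nonpos _ (num 3 * (P + C)) (num≥0 3 ⊗ (P≥0 ⊕ C≥0)) Corner.linear-bound

    module _ (w≤0 : w ≤ 0#) (p≤0 : p ≤ 0#) where

      A₂₃ : A 2F 3F ≡ 0#
      A₂₃ = ≤-antisym (≤0-right (A≥0 1F 3F) (≤0-left (A≥0 3F 3F) w≤0)) (A≥0 2F 3F)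

      A₃₃ : A 3F 3F ≡ 0#
      A₃₃ = ≤-antisym (≤0-right (A≥0 1F 3F ⊕ A≥0 2F 3F) w≤0) (A≥0 3F 3F)

      per₂≥0 : ∀ m n → NonNeg (per₂ (A 2F m) (A 2F n) (A 3F m) (A 3F n))
      per₂≥0 m n = A≥0 2F m ⊗ A≥0 3F n ⊕ A≥0 2F n ⊗ A≥0 3F m

      -- A nonnegative 2 × 2 matrix of permanent zero has a zero line. A zero row forms a 2 × 2 zero
      -- block with the top row of A, a zero column with the last column, where `A₂₃` and `A₃₃`
      -- vanish.
      minor-pos : ∀ m n → ∣ ⁅ m ⁆ ∪ ⁅ n ⁆ ∣ ≡ 2 → ∣ ⁅ m ⁆ ∪ ⁅ 3F ⁆ ∣ ≡ 2 → ∣ ⁅ n ⁆ ∪ ⁅ 3F ⁆ ∣ ≡ 2 →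
        A 0F m ≡ 0# → A 0F n ≡ 0# → ¬ (per₂ (A 2F m) (A 2F n) (A 3F m) (A 3F n) ≡ 0#)
      minor-pos m n mn m3 n3 A₀ₘ A₀ₙ per≡0 =
        noZeroBlock-pairs {0F} {3F} {m} {n} refl mn A-max A₀ₘ A₀ₙ A₃ₘ A₃ₙ
        where
        per≤0 = subst (_≤ 0#) (sym per≡0) (≤-refl 0#)
        A₂ₘA₃ₙ≤0 = ≤0-left (A≥0 2F n ⊗ A≥0 3F m) per≤0
        A₂ₙA₃ₘ≤0 = ≤0-right (A≥0 2F m ⊗ A≥0 3F n) per≤0
        A₂ₘ≢0 : ¬ (A 2F m ≡ 0#)
        A₂ₘ≢0 A₂ₘ = noZeroBlock-pairs {2F} {3F} {m} {3F} refl m3 A-max A₂ₘ A₂₃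
          (zero-product (A≥0 2F n) (A≥0 3F m) A₂ₙA₃ₘ≤0 (noZeroBlock-pairs {0F} {2F} {m} {n} refl mn A-max A₀ₘ A₀ₙ A₂ₘ)) A₃₃
        A₃ₙ : A 3F n ≡ 0#
        A₃ₙ = zero-product (A≥0 2F m) (A≥0 3F n) A₂ₘA₃ₙ≤0 A₂ₘ≢0
        A₃ₘ : A 3F m ≡ 0#
        A₃ₘ = zero-product (A≥0 2F n) (A≥0 3F m) A₂ₙA₃ₘ≤0 (λ A₂ₙ → noZeroBlock-pairs {2F} {3F} {n} {3F} refl n3 A-max A₂ₙ A₂₃ A₃ₙ A₃₃)

      -- Expand `p` along row 1. By `minor-pos` the minors of the entries in columns 0 and 1 cannot
      -- vanish, so both entries do, which makes a zero block with the top row.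
      degenerate : ⊥
      degenerate =
        minor-pos 1F 2F refl refl refl A₀₁ A₀₂ (zero-product (A≥0 1F 0F) (per₂≥0 1F 2F) term₀ λ A₁₀ →
        minor-pos 0F 2F refl refl refl A₀₀ A₀₂ (zero-product (A≥0 1F 1F) (per₂≥0 0F 2F) term₁ λ A₁₁ →
        noZeroBlock-pairs {0F} {1F} {0F} {1F} refl refl A-max A₀₀ A₀₁ A₁₀ A₁₁))
        where
        term₂≥0 = A≥0 1F 2F ⊗ per₂≥0 0F 1F
        term₀ = ≤0-left (A≥0 1F 1F ⊗ per₂≥0 0F 2F) (≤0-left term₂≥0 p≤0)
        term₁ = ≤0-right (A≥0 1F 0F ⊗ per₂≥0 1F 2F) (≤0-left term₂≥0 p≤0)

    impossible : ⊥
    -- The four conditions are known only up to double negation; the goal `⊥` allows them to be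
    -- assumed one after another.
    impossible = corner λ c → move₁ λ m₁ → move₂ λ m₂ → move₃ λ m₃ →
      degenerate (Stationary.w≤0 c m₁ m₂ m₃) (Stationary.p≤0 c m₁ m₂ m₃)

  noZeroBlock₁₃ : NoZeroBlock (initial 1) (initial 3)
  noZeroBlock₁₃ A max zeros = MaximizingZeroRow.impossible A max
    (zeros 0F 0F here here) (zeros 0F 1F here (there here)) (zeros 0F 2F here (there (there here)))

  -- Assembling the block shapes

  noZeroBlock-initial : ∀ m n → m ≥ 1 → n ≥ 1 → m ℕ.+ n ≡ 4 → NoZeroBlock (initial m) (initial n)
  noZeroBlock-initial 1 .3 _ _ refl = noZeroBlock₁₃
  noZeroBlock-initial 2 .2 _ _ refl = noZeroBlock₂₂
  noZeroBlock-initial 3 .1 _ _ refl = noZeroBlock-transpose {initial 3} {initial 1} noZeroBlock₁₃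
  noZeroBlock-initial 4 .0 _ () refl

theorem3p1 : (R : RealField) → let open OverReals R in
    (A : Matrix 4) → PhiMaximizing 4 A → FullyIndecomposable 4 A
theorem3p1 R A max (S , T , S≥1 , T≥1 , size , zeros) =
  noZeroBlock-sort {S} {T} (noZeroBlock-initial ∣ S ∣ ∣ T ∣ S≥1 T≥1 size) A max zeros
  where open Proof R
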